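{- Let $q>9$ be a prime power with $q\equiv 1 \pmod 4$. Every signed graph $G$ with maximum average degree $\mathrm{mad}(G) < 4-\frac{8}{q+3}$ admits a homomorphism to the signed graph $SP_q^+$. That is, $\chi_s(\mathcal{M}_{4-\frac{8}{q+3}}) \le q+1$.
   Context: A signed graph $G=(V,E,s)$ is a finite simple graph $(V,E)$ (no loops, no parallel edges) together with a signature $s:E\to\{ -1,+1\}$; edges with sign $+1$ are positive, with sign $-1$ negative. Switching a vertex $v$ reverses the sign of every edge incident to $v$; two signed graphs are switching equivalent if one can be obtained from the other by a sequence of switches. For signed graphs $G$ and $H$, a map $\varphi:V(G)\to V(H)$ is a homomorphism if there is a signed graph $G'$ switching equivalent to $G$ such that for every edge $uv$ of $G'$, $\varphi(u)\varphi(v)$ is an edge of $H$ with the same sign as $uv$ in $G'$. The chromatic number $\chi_s(G)$ is the minimum order of a signed graph $H$ such that $G$ admits a homomorphism to $H$; for a class $\mathcal{C}$ of signed graphs, $\chi_s(\mathcal{C})$ is the maximum of $\chi_s(G)$ over $G\in\mathcal{C}$. The maximum average degree $\mathrm{mad}(G)$ is the maximum of $2|E(H)|/|V(H)|$ over all (nonempty) subgraphs $H$ of the underlying graph; $\mathcal{M}_k$ denotes the class of signed graphs with $\mathrm{mad} < k$. For a prime power $q\equiv 1 \pmod 4$, the signed Paley graph $SP_q$ has vertex set the finite field $\mathbb{F}_q$, and any two distinct vertices $u,v$ are joined by a positive edge if $u-v$ is a square in $\mathbb{F}_q$ and by a negative edge otherwise. For a signed graph $H$, $H^+$ denotes the signed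 graph obtained from $H$ by adding one new vertex joined by a positive edge to every vertex of $H$. Thus $SP_q^+$ is a complete signed graph on $q+1$ vertices. -}

module Defs where

open import Algebra.Bundles using (CommutativeRing)
import Algebra.Properties.Ring as RingProperties
open import Algebra.Structures using (IsCommutativeRing)
open import Data.Bool.Base using (Bool; true; false; if_then_else_; _∨_)
open import Data.Bool.Properties using (∨-comm; T?)
open import Data.Empty using (⊥-elim)
open import Data.Fin.Base as Fin using (Fin; zero; suc)
import Data.Fin.Properties as Fin
import Data.Integer.Base as ℤ
open import Data.List.Base
  using (List; []; _∷_; _++_; map; concatMap; filter; foldr; length; allFin; cartesianProduct)
import Data.List.Extrema as Extrema
open import Data.List.Membership.Propositional using (_∈_)
open import Data.List.Membership.Propositional.Properties using (∈-∃++; ∈-allFin; ∈-map⁺)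
open import Data.List.Properties using (length-map; length-tabulate)
open import Data.List.Relation.Binary.Permutation.Propositional
  using (_↭_; prep; ↭-refl; ↭-trans; ↭-sym; ↭-reflexive; ↭⇒↭ₛ)
open import Data.List.Relation.Binary.Permutation.Propositional.Properties
  using (∈-resp-↭; ↭-length; shift)
import Data.List.Relation.Binary.Permutation.Setoid.Properties as PermutationSetoid
open import Data.List.Relation.Unary.All as All using (All)
open import Data.List.Relation.Unary.AllPairs using (_∷_)
open import Data.List.Relation.Unary.Any using (here; there)
open import Data.List.Relation.Unary.Unique.Propositional using (Unique)
import Data.List.Relation.Unary.Unique.Propositional.Properties as Unique
open import Data.Maybe.Base using (Maybe; just; nothing; is-just)
import Data.Maybe.Base as Maybe
open import Data.Nat.Base as ℕ using (ℕ; zero; suc; s≤s)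
open import Data.Nat.DivMod using (_%_; _/_; m≡m%n+[m/n]*n)
open import Data.Nat.Primality using (Prime)
import Data.Nat.Properties as ℕ
open import Data.Product.Base using (Σ; ∃; ∃₂; _×_; _,_; proj₁; proj₂)
open import Data.Rational.Base as ℚ using (ℚ; 0ℚ)
import Data.Rational.Properties as ℚ
open import Data.Sign.Base as Sign using (Sign; opposite)
open import Function.Base using (_∘_)
open import Function.Bundles using (_↔_; Inverse)
open import Level using (0ℓ)
open import Relation.Binary.Bundles using (DecTotalOrder)
open import Relation.Binary.Construct.Closure.ReflexiveTransitive using (Star)
open import Relation.Binary.Definitions using (DecidableEquality)
open import Relation.Binary.PropositionalEquality
  using (_≡_; _≢_; refl; sym; trans; cong; cong₂; subst; setoid; module ≡-Reasoning)
open import Relation.Nullary using (Dec; yes; no; ¬_; ⌊_⌋; _×-dec_)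
open import Relation.Nullary.Decidable using (map′)

------------------------------------------------------------------------
-- Signed graphs

-- sign u v is nothing when uv is not an edge, and just s when uv is an
-- edge of sign s.
record SignedGraph (n : ℕ) : Set where
  field
    sign      : Fin n → Fin n → Maybe Sign
    symmetric : ∀ u v → sign u v ≡ sign v u
    loopless  : ∀ v → sign v v ≡ nothing

open SignedGraph public

-- An edge uv has u ≠ v, so it is incident to x exactly when the Boolean
-- below is true; non-edges are unaffected since they carry no sign.
switch : ∀ {n} → Fin n → SignedGraph n → SignedGraph n
switch {n} x G = record
  { sign      = λ u v → reverseIf (incident u v) (sign G u v)
  ; symmetric = λ u v → cong₂ reverseIf (∨-comm ⌊ u Fin.≟ x ⌋ ⌊ v Fin.≟ x ⌋) (symmetric G u v)
  ; loopless  = λ v → trans (cong (reverseIf (incident v v)) (loopless G v))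
                            (reverseIf-nothing (incident v v))
  }
  where
  incident : Fin n → Fin n → Bool
  incident u v = ⌊ u Fin.≟ x ⌋ ∨ ⌊ v Fin.≟ x ⌋

  reverseIf : Bool → Maybe Sign → Maybe Sign
  reverseIf b s = if b then Maybe.map opposite s else s

  reverseIf-nothing : ∀ b → reverseIf b nothing ≡ nothing
  reverseIf-nothing true  = refl
  reverseIf-nothing false = refl

-- Signed graphs are compared by their sign functions only, since the
-- proof fields of the record need not be propositionally equal.
SwitchesTo : ∀ {n} → SignedGraph n → SignedGraph n → Set
SwitchesTo G G′ = ∃ λ x → ∀ u v → sign G′ u v ≡ sign (switch x G) u v

SwitchingEquivalent : ∀ {n} → SignedGraph n → SignedGraph n → Set
SwitchingEquivalent = Star SwitchesTo

IsHomomorphism : ∀ {m n} → SignedGraph m → SignedGraph n → (Fin m → Fin n) → Set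
IsHomomorphism G H φ = ∃ λ G′ → SwitchingEquivalent G G′ ×
  (∀ u v s → sign G′ u v ≡ just s → sign H (φ u) (φ v) ≡ just s)

infix 4 _⟶_

_⟶_ : ∀ {m n} → SignedGraph m → SignedGraph n → Set
G ⟶ H = ∃ (IsHomomorphism G H)

------------------------------------------------------------------------
-- Chromatic number

IsChromaticNumber : ∀ {n} → SignedGraph n → ℕ → Set
IsChromaticNumber G k =
  Σ (SignedGraph k) (λ H → G ⟶ H) ×
  (∀ {m} (H : SignedGraph m) → G ⟶ H → k ℕ.≤ m)

GraphClass : Set₁
GraphClass = ∀ {n} → SignedGraph n → Set

-- χₛ(C) ≤ k. As χₛ(C) is the maximum of χₛ over C, this says that every
-- member of C has a chromatic number and that it is at most k.
χₛ[_]≤_ : GraphClass → ℕ → Set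
χₛ[ C ]≤ k = ∀ {n} (G : SignedGraph n) → C G → ∃ λ j → IsChromaticNumber G j × j ℕ.≤ k

------------------------------------------------------------------------
-- Maximum average degree

sublists : ∀ {A : Set} → List A → List (List A)
sublists []       = [] ∷ []
sublists (x ∷ xs) = map (x ∷_) (sublists xs) ++ sublists xs

module _ {n : ℕ} (G : SignedGraph n) where

  open import Data.List.Membership.DecPropositional (Fin._≟_ {n}) using (_∈?_)

  -- Each edge is listed once, with its smaller endpoint first.
  edges : List (Fin n × Fin n)
  edges = filter (λ (u , v) → u Fin.<? v ×-dec T? (is-just (sign G u v)))
                 (cartesianProduct (allFin n) (allFin n))

  edgesWithin : List (Fin n) → List (Fin n × Fin n)
  edgesWithin U = filter (λ (u , v) → u ∈? U ×-dec v ∈? U) edges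

  -- The average degrees 2|F| / |U| of all subgraphs with vertex set U
  -- and edge set F, for U nonempty.
  averageDegreesOn : List (Fin n) → List ℚ
  averageDegreesOn []        = []
  averageDegreesOn U@(_ ∷ _) =
    map (λ F → ℤ.+ (2 ℕ.* length F) ℚ./ length U) (sublists (edgesWithin U))

  -- Average degrees are nonnegative, so the base value 0 only matters
  -- for the graph without vertices.
  mad : ℚ
  mad = Extrema.max (DecTotalOrder.totalOrder ℚ.≤-decTotalOrder) 0ℚ
          (concatMap averageDegreesOn (sublists (allFin n)))

𝓜 : ℚ → GraphClass
𝓜 k G = mad G ℚ.< k

------------------------------------------------------------------------
-- Finite fields

IsPrimePower : ℕ → Set
IsPrimePower q = ∃₂ λ p k → Prime p × 1 ℕ.≤ k × q ≡ p ℕ.^ k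

record FiniteField (q : ℕ) : Set₁ where
  infix  8 -_
  infix  9 _⁻¹
  infixl 7 _*_
  infixl 6 _+_
  field
    Carrier           : Set
    _+_ _*_           : Carrier → Carrier → Carrier
    -_ _⁻¹            : Carrier → Carrier
    0# 1#             : Carrier
    isCommutativeRing : IsCommutativeRing _≡_ _+_ _*_ -_ 0# 1#
    0≢1               : 0# ≢ 1#
    inverseʳ          : ∀ x → x ≢ 0# → x * x ⁻¹ ≡ 1#
    enumeration       : Fin q ↔ Carrier

  commutativeRing : CommutativeRing 0ℓ 0ℓ
  commutativeRing = record { isCommutativeRing = isCommutativeRing }

  open CommutativeRing commutativeRing public using (_-_)

  element : Fin q → Carrier
  element = Inverse.to enumeration

  index : Carrier → Fin q
  index = Inverse.from enumeration

  element-index : ∀ x → element (index x) ≡ x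
  element-index = Inverse.strictlyInverseˡ enumeration

  element-injective : ∀ {i j} → element i ≡ element j → i ≡ j
  element-injective {i} {j} eq =
    trans (sym (Inverse.strictlyInverseʳ enumeration i))
      (trans (cong index eq) (Inverse.strictlyInverseʳ enumeration j))

  _≟_ : DecidableEquality Carrier
  x ≟ y = map′ (λ eq → trans (sym (element-index x)) (trans (cong element eq) (element-index y)))
               (cong index) (index x Fin.≟ index y)

  IsSquare : Carrier → Set
  IsSquare x = ∃ λ y → x ≡ y * y

  isSquare? : ∀ x → Dec (IsSquare x)
  isSquare? x =
    map′ (λ (i , eq) → element i , eq)
         (λ (y , eq) → index y , trans eq (sym (cong₂ _*_ (element-index y) (element-index y))))
         (Fin.any? (λ i → x ≟ (element i * element i)))

------------------------------------------------------------------------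
-- If q ≡ 1 (mod 4) then -1 is a square in the field with q elements.
-- This makes the adjacency of the signed Paley graph symmetric.

module _ {A : Set} where

  Unique-resp-↭ : {xs ys : List A} → xs ↭ ys → Unique xs → Unique ys
  Unique-resp-↭ p = PermutationSetoid.Unique-resp-↭ (setoid A) (↭⇒↭ₛ p)

  extract : ∀ {x : A} {xs} → x ∈ xs → ∃ λ zs → xs ↭ x ∷ zs
  extract x∈xs with as , bs , eq ← ∈-∃++ x∈xs =
    as ++ bs , ↭-trans (↭-reflexive eq) (shift _ as bs)

module _ {A : Set} (f : A → A) where

  data Paired : List A → Set where
    done : Paired []
    pair : ∀ {xs} x {zs} → xs ↭ x ∷ f x ∷ zs → Paired zs → Paired xs

  paired : ∀ n xs → length xs ℕ.≤ n → Unique xs →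
           (∀ {x} → x ∈ xs → f x ∈ xs) →
           (∀ {x} → x ∈ xs → f x ≢ x) →
           (∀ {x} → x ∈ xs → f (f x) ≡ x) → Paired xs
  paired _       []       _         _ _ _ _ = done
  paired (suc n) (x ∷ ys) (s≤s ys≤n) unique closed apart involutive
    with closed (here refl)
  ... | here fx≡x = ⊥-elim (apart (here refl) fx≡x)
  ... | there fx∈ys with zs , ys↭ ← extract fx∈ys =
      pair x xs↭ (paired n zs zs≤n (tailUnique unique′) closed′
                    (apart ∘ inject) (involutive ∘ inject))
    where
    xs↭ : x ∷ ys ↭ x ∷ f x ∷ zs
    xs↭ = prep x ys↭

    unique′ : Unique (x ∷ f x ∷ zs)
    unique′ = Unique-resp-↭ xs↭ unique

    tailUnique : Unique (x ∷ f x ∷ zs) → Unique zs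
    tailUnique (_ ∷ _ ∷ u) = u

    x∉zs : Unique (x ∷ f x ∷ zs) → ¬ x ∈ zs
    x∉zs (x∉ ∷ _) x∈ = All.lookup x∉ (there x∈) refl

    fx∉zs : Unique (x ∷ f x ∷ zs) → ¬ f x ∈ zs
    fx∉zs (_ ∷ fx∉ ∷ _) fx∈ = All.lookup fx∉ fx∈ refl

    zs≤n : length zs ℕ.≤ n
    zs≤n = ℕ.≤-trans (ℕ.n≤1+n _) (subst (ℕ._≤ n) (↭-length ys↭) ys≤n)

    inject : ∀ {y} → y ∈ zs → y ∈ x ∷ ys
    inject y∈ = ∈-resp-↭ (↭-sym xs↭) (there (there y∈))

    closed′ : ∀ {y} → y ∈ zs → f y ∈ zs
    closed′ {y} y∈ with ∈-resp-↭ xs↭ (closed (inject y∈))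
    ... | here fy≡x = ⊥-elim (fx∉zs unique′
            (subst (_∈ zs) (trans (sym (involutive (inject y∈))) (cong f fy≡x)) y∈))
    ... | there (here fy≡fx) = ⊥-elim (x∉zs unique′
            (subst (_∈ zs) (trans (sym (involutive (inject y∈)))
                              (trans (cong f fy≡fx) (involutive (here refl)))) y∈))
    ... | there (there fy∈) = fy∈

module _ {q : ℕ} (F : FiniteField q) where

  open FiniteField F
  open CommutativeRing commutativeRing
    using (ring; *-isCommutativeMonoid; *-assoc; *-comm; *-identityˡ; *-identityʳ; zeroʳ
          ; distribʳ; distribˡ; +-identityˡ; +-assoc; +-comm; -‿inverseˡ; -‿inverseʳ)
  open RingProperties ring
    using (-‿distribˡ-*; -‿distribʳ-*; -‿involutive; -0#≈0#; -‿anti-homo-+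
          ; -1*x≈-x; +-inverseʳ-unique)
  open ≡-Reasoning

  product : List Carrier → Carrier
  product = foldr _*_ 1#

  product-↭ : ∀ {xs ys} → xs ↭ ys → product xs ≡ product ys
  product-↭ p = PermutationSetoid.foldr-commMonoid (setoid Carrier) *-isCommutativeMonoid (↭⇒↭ₛ p)

  -[-1]≡1 : - (- 1#) ≡ 1#
  -[-1]≡1 = -‿involutive 1#

  -1*-1≡1 : (- 1#) * (- 1#) ≡ 1#
  -1*-1≡1 = trans (-1*x≈-x (- 1#)) -[-1]≡1

  cancelˡ : ∀ {x y} → x ≢ 0# → x * y ≡ 0# → y ≡ 0#
  cancelˡ {x} {y} x≢0 xy≡0 = begin
    y                 ≡⟨ *-identityˡ y ⟨
    1# * y            ≡⟨ cong (_* y) (trans (*-comm (x ⁻¹) x) (inverseʳ x x≢0)) ⟨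
    x ⁻¹ * x * y      ≡⟨ *-assoc _ x y ⟩
    x ⁻¹ * (x * y)    ≡⟨ cong (x ⁻¹ *_) xy≡0 ⟩
    x ⁻¹ * 0#         ≡⟨ zeroʳ _ ⟩
    0#                ∎

  ⁻¹≢0 : ∀ {x} → x ≢ 0# → x ⁻¹ ≢ 0#
  ⁻¹≢0 {x} x≢0 eq = 0≢1 (begin
    0#        ≡⟨ zeroʳ x ⟨
    x * 0#    ≡⟨ cong (x *_) eq ⟨
    x * x ⁻¹  ≡⟨ inverseʳ x x≢0 ⟩
    1#        ∎)

  ⁻¹-unique : ∀ {x y} → x ≢ 0# → x * y ≡ 1# → x ⁻¹ ≡ y
  ⁻¹-unique {x} {y} x≢0 xy≡1 = begin
    x ⁻¹              ≡⟨ *-identityʳ _ ⟨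
    x ⁻¹ * 1#         ≡⟨ cong (x ⁻¹ *_) xy≡1 ⟨
    x ⁻¹ * (x * y)    ≡⟨ *-assoc _ x y ⟨
    x ⁻¹ * x * y      ≡⟨ cong (_* y) (trans (*-comm (x ⁻¹) x) (inverseʳ x x≢0)) ⟩
    1# * y            ≡⟨ *-identityˡ y ⟩
    y                 ∎

  ⁻¹-involutive : ∀ {x} → x ≢ 0# → (x ⁻¹) ⁻¹ ≡ x
  ⁻¹-involutive {x} x≢0 = ⁻¹-unique (⁻¹≢0 x≢0) (trans (*-comm (x ⁻¹) x) (inverseʳ x x≢0))

  -‿≢0 : ∀ {x} → x ≢ 0# → - x ≢ 0#
  -‿≢0 {x} x≢0 eq = x≢0 (trans (sym (-‿involutive x)) (trans (cong -_ eq) -0#≈0#))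

  -- x² - 1 = (x + 1)(x - 1)
  squareRootsOfOne : ∀ {x} → x * x ≡ 1# → x ≢ - 1# → x ≡ 1#
  squareRootsOfOne {x} xx≡1 x≢-1 =
    trans (+-inverseʳ-unique (- 1#) x
             (trans (+-comm (- 1#) x) (cancelˡ x+1≢0 factored)))
          -[-1]≡1
    where
    x+1≢0 : x + 1# ≢ 0#
    x+1≢0 eq = x≢-1 (+-inverseʳ-unique 1# x
                       (trans (+-comm 1# x) eq))

    factored : (x + 1#) * (x + - 1#) ≡ 0#
    factored = begin
      (x + 1#) * (x + - 1#)                   ≡⟨ distribʳ (x + - 1#) x 1# ⟩
      x * (x + - 1#) + 1# * (x + - 1#)        ≡⟨ cong₂ _+_ (distribˡ x x (- 1#)) (*-identityˡ _) ⟩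
      x * x + x * - 1# + (x + - 1#)           ≡⟨ cong₂ (λ a b → a + b + (x + - 1#)) xx≡1
                                                  (trans (*-comm x (- 1#)) (-1*x≈-x x)) ⟩
      1# + - x + (x + - 1#)                   ≡⟨ +-assoc 1# (- x) _ ⟩
      1# + (- x + (x + - 1#))                 ≡⟨ cong (1# +_) (+-assoc (- x) x (- 1#)) ⟨
      1# + (- x + x + - 1#)                   ≡⟨ cong (λ a → 1# + (a + - 1#)) (-‿inverseˡ x) ⟩
      1# + (0# + - 1#)                        ≡⟨ cong (1# +_) (+-identityˡ _) ⟩
      1# + - 1#                               ≡⟨ -‿inverseʳ 1# ⟩
      0#                                      ∎

  allElements : List Carrier
  allElements = map element (allFin q)

  ∈-allElements : ∀ x → x ∈ allElements
  ∈-allElements x = subst (_∈ allElements) (element-index x) (∈-map⁺ element (∈-allFin (index x)))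

  allElements-unique : Unique allElements
  allElements-unique = Unique.map⁺ element-injective (Unique.allFin⁺ q)

  nonzeroSplit : ∃ λ zs → allElements ↭ 0# ∷ zs
  nonzeroSplit = extract (∈-allElements 0#)

  nonzero : List Carrier
  nonzero = proj₁ nonzeroSplit

  0∷nonzero-unique : Unique (0# ∷ nonzero)
  0∷nonzero-unique = Unique-resp-↭ (proj₂ nonzeroSplit) allElements-unique

  nonzero-unique : Unique nonzero
  nonzero-unique with 0∷nonzero-unique
  ... | _ ∷ u = u

  ∈-nonzero⁻ : ∀ {x} → x ∈ nonzero → x ≢ 0#
  ∈-nonzero⁻ x∈ x≡0 with 0∷nonzero-unique
  ... | 0∉ ∷ _ = All.lookup 0∉ x∈ (sym x≡0)

  ∈-nonzero⁺ : ∀ {x} → x ≢ 0# → x ∈ nonzero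
  ∈-nonzero⁺ {x} x≢0 with ∈-resp-↭ (proj₂ nonzeroSplit) (∈-allElements x)
  ... | here x≡0 = ⊥-elim (x≢0 x≡0)
  ... | there x∈ = x∈

  suc-length-nonzero : suc (length nonzero) ≡ q
  suc-length-nonzero = trans (sym (↭-length (proj₂ nonzeroSplit)))
    (trans (length-map element (allFin q)) (length-tabulate {n = q} (λ i → i)))

  -1^ : ℕ → Carrier
  -1^ zero    = 1#
  -1^ (suc k) = - (-1^ k)

  -1^even : ∀ k → -1^ (k ℕ.* 2) ≡ 1#
  -1^even zero    = refl
  -1^even (suc k) = trans (-‿involutive _) (-1^even k)

  product-⁻¹ : ∀ {xs} → Paired _⁻¹ xs → (∀ {x} → x ∈ xs → x ≢ 0#) → product xs ≡ 1#
  product-⁻¹ done _ = refl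
  product-⁻¹ {xs} (pair x {zs} xs↭ p) ≢0 = begin
    product xs                  ≡⟨ product-↭ xs↭ ⟩
    x * (x ⁻¹ * product zs)     ≡⟨ *-assoc x _ _ ⟨
    x * x ⁻¹ * product zs       ≡⟨ cong₂ _*_ (inverseʳ x (≢0 (∈-resp-↭ (↭-sym xs↭) (here refl))))
                                     (product-⁻¹ p (≢0 ∘ ∈-resp-↭ (↭-sym xs↭) ∘ there ∘ there)) ⟩
    1# * 1#                     ≡⟨ *-identityˡ 1# ⟩
    1#                          ∎

  product-neg : ∀ {xs} → Paired -_ xs →
                ∃₂ λ k s → length xs ≡ k ℕ.* 2 × product xs ≡ -1^ k * (s * s)
  product-neg done = 0 , 1# , refl , sym (trans (*-identityˡ _) (*-identityˡ 1#))
  product-neg {xs} (pair x {zs} xs↭ p) with k , s , len , eq ← product-neg p =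
    suc k , x * s , trans (↭-length xs↭) (cong (2 ℕ.+_) len) , (begin
      product xs                        ≡⟨ product-↭ xs↭ ⟩
      x * (- x * product zs)            ≡⟨ cong (λ a → x * (- x * a)) eq ⟩
      x * (- x * (-1^ k * (s * s)))     ≡⟨ cong (x *_) (-‿distribˡ-* x _) ⟨
      x * - (x * (-1^ k * (s * s)))     ≡⟨ -‿distribʳ-* x _ ⟨
      - (x * (x * (-1^ k * (s * s))))   ≡⟨ cong -_ (rearrange x (-1^ k) s) ⟩
      - (-1^ k * ((x * s) * (x * s)))   ≡⟨ -‿distribˡ-* _ _ ⟩
      - (-1^ k) * ((x * s) * (x * s))   ∎)
    where
    rearrange : ∀ x e s → x * (x * (e * (s * s))) ≡ e * ((x * s) * (x * s))
    rearrange x e s = begin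
      x * (x * (e * (s * s)))   ≡⟨ *-assoc x x _ ⟨
      x * x * (e * (s * s))     ≡⟨ *-assoc (x * x) e _ ⟨
      x * x * e * (s * s)       ≡⟨ cong (_* (s * s)) (*-comm (x * x) e) ⟩
      e * (x * x) * (s * s)     ≡⟨ *-assoc e _ _ ⟩
      e * (x * x * (s * s))     ≡⟨ cong (e *_) (interchange x s) ⟩
      e * (x * s * (x * s))     ∎
      where
      interchange : ∀ x s → x * x * (s * s) ≡ x * s * (x * s)
      interchange x s = begin
        x * x * (s * s)     ≡⟨ *-assoc x x _ ⟩
        x * (x * (s * s))   ≡⟨ cong (x *_) (*-assoc x s s) ⟨
        x * (x * s * s)     ≡⟨ cong (x *_) (*-comm (x * s) s) ⟩
        x * (s * (x * s))   ≡⟨ *-assoc x s _ ⟨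
        x * s * (x * s)     ∎

  module _ (1≢-1 : 1# ≢ - 1#) where

    -x≢x : ∀ {x} → x ≢ 0# → - x ≢ x
    -x≢x {x} x≢0 -x≡x = 1≢-1 (begin
      1#                ≡⟨ inverseʳ x x≢0 ⟨
      x * x ⁻¹          ≡⟨ cong (_* x ⁻¹) -x≡x ⟨
      - x * x ⁻¹        ≡⟨ -‿distribˡ-* x _ ⟨
      - (x * x ⁻¹)      ≡⟨ cong -_ (inverseʳ x x≢0) ⟩
      - 1#              ∎)

    nonzero-pairedByNeg : Paired -_ nonzero
    nonzero-pairedByNeg = paired -_ (length nonzero) nonzero ℕ.≤-refl nonzero-unique
      (∈-nonzero⁺ ∘ -‿≢0 ∘ ∈-nonzero⁻) (-x≢x ∘ ∈-nonzero⁻) (λ _ → -‿involutive _)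

    -- Wilson's theorem
    product-nonzero : product nonzero ≡ - 1#
    product-nonzero
      with zs , nz↭ ← extract (∈-nonzero⁺ (0≢1 ∘ sym))
      with ∈-resp-↭ nz↭ (∈-nonzero⁺ (-‿≢0 (0≢1 ∘ sym)))
    ... | here -1≡1 = ⊥-elim (1≢-1 (sym -1≡1))
    ... | there -1∈zs with rest , zs↭ ← extract -1∈zs = begin
        product nonzero                ≡⟨ product-↭ split ⟩
        1# * (- 1# * product rest)     ≡⟨ *-identityˡ _ ⟩
        - 1# * product rest            ≡⟨ cong (- 1# *_) (product-⁻¹ restPaired rest≢0) ⟩
        - 1# * 1#                      ≡⟨ *-identityʳ _ ⟩
        - 1#                           ∎
      where
      split : nonzero ↭ 1# ∷ - 1# ∷ rest
      split = ↭-trans nz↭ (prep 1# zs↭)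

      unique′ : Unique (1# ∷ - 1# ∷ rest)
      unique′ = Unique-resp-↭ split nonzero-unique

      rest-unique : Unique (1# ∷ - 1# ∷ rest) → Unique rest
      rest-unique (_ ∷ _ ∷ u) = u

      rest≢1 : Unique (1# ∷ - 1# ∷ rest) → ∀ {x} → x ∈ rest → x ≢ 1#
      rest≢1 (1∉ ∷ _) x∈ x≡1 = All.lookup 1∉ (there x∈) (sym x≡1)

      rest≢-1 : Unique (1# ∷ - 1# ∷ rest) → ∀ {x} → x ∈ rest → x ≢ - 1#
      rest≢-1 (_ ∷ -1∉ ∷ _) x∈ x≡-1 = All.lookup -1∉ x∈ (sym x≡-1)

      rest≢0 : ∀ {x} → x ∈ rest → x ≢ 0#
      rest≢0 = ∈-nonzero⁻ ∘ ∈-resp-↭ (↭-sym split) ∘ there ∘ there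

      fromInverse : ∀ {x y} → x ≢ 0# → y * y ≡ 1# → x ⁻¹ ≡ y → x ≡ y
      fromInverse x≢0 yy≡1 refl =
        trans (sym (⁻¹-involutive x≢0)) (⁻¹-unique (⁻¹≢0 x≢0) yy≡1)

      rest-closed : ∀ {x} → x ∈ rest → x ⁻¹ ∈ rest
      rest-closed x∈ with ∈-resp-↭ split (∈-nonzero⁺ (⁻¹≢0 (rest≢0 x∈)))
      ... | here eq = ⊥-elim (rest≢1 unique′ x∈ (fromInverse (rest≢0 x∈) (*-identityˡ 1#) eq))
      ... | there (here eq) = ⊥-elim (rest≢-1 unique′ x∈ (fromInverse (rest≢0 x∈) -1*-1≡1 eq))
      ... | there (there x⁻¹∈) = x⁻¹∈

      rest-apart : ∀ {x} → x ∈ rest → x ⁻¹ ≢ x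
      rest-apart {x} x∈ eq = rest≢1 unique′ x∈
        (squareRootsOfOne (trans (cong (x *_) (sym eq)) (inverseʳ x (rest≢0 x∈)))
                          (rest≢-1 unique′ x∈))

      restPaired : Paired _⁻¹ rest
      restPaired = paired _⁻¹ (length rest) rest ℕ.≤-refl (rest-unique unique′)
        rest-closed rest-apart (⁻¹-involutive ∘ rest≢0)

  module _ (q≡1 : q % 4 ≡ 1) where

    -1-isSquare : IsSquare (- 1#)
    -1-isSquare with 1# ≟ (- 1#)
    ... | yes 1≡-1 = 1# , trans (sym 1≡-1) (sym (*-identityˡ 1#))
    ... | no 1≢-1 with k , s , len , eq ← product-neg (nonzero-pairedByNeg 1≢-1) =
      s , (begin
        - 1#                ≡⟨ product-nonzero 1≢-1 ⟨
        product nonzero     ≡⟨ eq ⟩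
        -1^ k * (s * s)     ≡⟨ cong (_* (s * s)) (trans (cong -1^ k-even) (-1^even (q / 4))) ⟩
        1# * (s * s)        ≡⟨ *-identityˡ _ ⟩
        s * s               ∎)
      where
      k-even : k ≡ (q / 4) ℕ.* 2
      k-even = ℕ.*-cancelʳ-≡ k _ 2 (ℕ.suc-injective (begin
        suc (k ℕ.* 2)                   ≡⟨ cong suc len ⟨
        suc (length nonzero)            ≡⟨ suc-length-nonzero ⟩
        q                               ≡⟨ m≡m%n+[m/n]*n q 4 ⟩
        q % 4 ℕ.+ (q / 4) ℕ.* 4         ≡⟨ cong₂ ℕ._+_ q≡1 (sym (ℕ.*-assoc (q / 4) 2 2)) ⟩
        suc ((q / 4) ℕ.* 2 ℕ.* 2)       ∎))

    isSquare-swap : ∀ x y → IsSquare (x - y) → IsSquare (y - x)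
    isSquare-swap x y (z , x-y≡zz) with i , -1≡ii ← -1-isSquare = i * z , (begin
      y - x               ≡⟨ cong (_- x) (-‿involutive y) ⟨
      - (- y) + - x       ≡⟨ -‿anti-homo-+ x (- y) ⟨
      - (x - y)           ≡⟨ cong -_ x-y≡zz ⟩
      - (z * z)           ≡⟨ -1*x≈-x _ ⟨
      - 1# * (z * z)      ≡⟨ cong (_* (z * z)) -1≡ii ⟩
      i * i * (z * z)     ≡⟨ *-assoc i i _ ⟩
      i * (i * (z * z))   ≡⟨ cong (i *_) (*-assoc i z z) ⟨
      i * (i * z * z)     ≡⟨ cong (i *_) (*-comm (i * z) z) ⟩
      i * (z * (i * z))   ≡⟨ *-assoc i z _ ⟨
      i * z * (i * z)     ∎)

------------------------------------------------------------------------
-- The signed Paley graph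

    -- Vertex i stands for the field element with index i.
    SP : SignedGraph q
    SP = record { sign = paleySign ; symmetric = paleySign-symmetric ; loopless = paleySign-loopless }
      where
      paleySign : Fin q → Fin q → Maybe Sign
      paleySign i j with i Fin.≟ j | isSquare? (element i - element j)
      ... | yes _ | _     = nothing
      ... | no  _ | yes _ = just Sign.+
      ... | no  _ | no  _ = just Sign.-

      paleySign-symmetric : ∀ i j → paleySign i j ≡ paleySign j i
      paleySign-symmetric i j
        with i Fin.≟ j | isSquare? (element i - element j)
           | j Fin.≟ i | isSquare? (element j - element i)
      ... | yes _   | _      | yes _   | _      = refl
      ... | yes i≡j | _      | no j≢i  | _      = ⊥-elim (j≢i (sym i≡j))
      ... | no i≢j  | _      | yes j≡i | _      = ⊥-elim (i≢j (sym j≡i))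
      ... | no _    | yes _  | no _    | yes _  = refl
      ... | no _    | yes sq | no _    | no ¬sq = ⊥-elim (¬sq (isSquare-swap _ _ sq))
      ... | no _    | no ¬sq | no _    | yes sq = ⊥-elim (¬sq (isSquare-swap _ _ sq))
      ... | no _    | no _   | no _    | no _   = refl

      paleySign-loopless : ∀ i → paleySign i i ≡ nothing
      paleySign-loopless i with i Fin.≟ i
      ... | yes _   = refl
      ... | no  i≢i = ⊥-elim (i≢i refl)

infix 9 _⁺

-- The new vertex is zero.
_⁺ : ∀ {n} → SignedGraph n → SignedGraph (suc n)
_⁺ {n} H = record { sign = sign⁺ ; symmetric = sign⁺-symmetric ; loopless = sign⁺-loopless }
  where
  sign⁺ : Fin (suc n) → Fin (suc n) → Maybe Sign
  sign⁺ zero    zero    = nothing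
  sign⁺ zero    (suc _) = just Sign.+
  sign⁺ (suc _) zero    = just Sign.+
  sign⁺ (suc u) (suc v) = sign H u v

  sign⁺-symmetric : ∀ u v → sign⁺ u v ≡ sign⁺ v u
  sign⁺-symmetric zero    zero    = refl
  sign⁺-symmetric zero    (suc _) = refl
  sign⁺-symmetric (suc _) zero    = refl
  sign⁺-symmetric (suc u) (suc v) = symmetric H u v

  sign⁺-loopless : ∀ v → sign⁺ v v ≡ nothing
  sign⁺-loopless zero    = refl
  sign⁺-loopless (suc v) = loopless H v

{-# OPTIONS --safe #-}
module Submission where

-- Passing to the double cover of the target H = SP_q⁺, a homomorphism
-- becomes a map of the vertices of G to colours (vertices of H with a
-- sign), and every coloured neighbour of a vertex imposes one constraint
-- on its colour. The signed adjacency matrix of H is a symmetric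
-- conference matrix, because Σ χ(x) = 0 and Σ χ(x)χ(x + c) = -1; so, if
-- q = 5 + 4p, at least 12 + 8p, 5 + 4p, 2 + 2p and p colours satisfy 0, 1,
-- 2 and 3 consistent constraints. An uncoloured vertex of degree d ≤ 3
-- excludes at most d - 1 colours of a neighbour a. Hence a star of vertices
-- of degree at most 3 around a is reducible when the total number of
-- excluded colours is less than the number of colours available to a:
-- delete its edges, colour the rest, recolour a, and then the leaves.
-- Without reducible stars, discharging from each vertex to its neighbours
-- of degree 2 and 3 shows that the average degree of the nonisolated
-- vertices is at least 4 - 8/(q + 3).

open import Defs
open import Algebra.Bundles using (CommutativeRing)
import Algebra.Properties.Ring as RingProperties
import Algebra.Properties.Semiring.Sum as SemiringSum
import Algebra.Solver.Ring.NaturalCoefficients.Default as NaturalCoefficients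
open import Data.Bool.Base using (Bool; true; false; if_then_else_; _∧_; _∨_; T)
open import Data.Bool.Properties as Bool using (∨-comm; T?)
open import Data.Empty using (⊥-elim)
open import Data.Fin.Base as Fin using (Fin; zero; suc)
import Data.Fin.Permutation as Permutation
import Data.Fin.Properties as Fin
open import Data.Integer.Base as ℤ using (ℤ; 0ℤ; 1ℤ; -1ℤ; +_)
import Data.Integer.Properties as ℤ
import Data.Integer.Tactic.RingSolver as ℤSolver
open import Data.List.Base as List using (List; []; _∷_; length; map; allFin)
import Data.List.Extrema as Extrema
open import Data.List.Membership.Propositional using (_∈_)
open import Data.List.Membership.Propositional.Properties
  using (∈-allFin; ∈-++⁺ˡ; ∈-++⁺ʳ; ∈-map⁺; ∈-concatMap⁺; ∈-filter⁺; ∈-filter⁻)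
open import Data.List.Properties using (length-map; length-tabulate; length-++; filter-++; map-tabulate)
open import Data.List.Relation.Binary.Permutation.Propositional.Properties using (↭-length)
open import Data.List.Relation.Unary.All as All using (All; []; _∷_)
open import Data.List.Relation.Unary.AllPairs using (AllPairs; []; _∷_)
open import Data.List.Relation.Unary.Any as Any using (here; there)
open import Data.Maybe.Base as Maybe using (Maybe; just; nothing; is-just)
import Data.Maybe.Properties as Maybe
open import Data.Nat.Base as ℕ using (ℕ; zero; suc; _<_; z≤n; s≤s) renaming (_+_ to _+ℕ_)
open import Data.Nat.DivMod using (_%_; m≡m%n+[m/n]*n)
open import Data.Nat.Induction using (<-rec)
import Data.Nat.Properties as ℕ
import Data.Nat.Tactic.RingSolver as ℕSolver
open import Data.Product.Base as Product using (Σ; ∃; ∃₂; _×_; _,_; proj₁; proj₂)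
import Data.Product.Properties as Product
import Data.Rational.Properties as ℚ
open import Data.Rational.Unnormalised.Base as ℚᵘ using (mkℚᵘ)
import Data.Rational.Unnormalised.Properties as ℚᵘ
open import Data.Sign.Base as Sign using (Sign; opposite)
import Data.Sign.Properties as Sign
open import Data.Sum.Base using (_⊎_; inj₁; inj₂; [_,_]′)
open import Function.Base using (_∘_; id; case_of_)
open import Relation.Binary.Bundles using (DecTotalOrder)
open import Relation.Binary.Construct.Closure.ReflexiveTransitive using (ε; _◅_)
open import Relation.Binary.Definitions using (DecidableEquality; tri<; tri≈; tri>)
open import Relation.Binary.PropositionalEquality
  using (_≡_; _≢_; refl; sym; trans; cong; cong₂; subst; subst₂; module ≡-Reasoning)
open import Relation.Nullary using (Dec; yes; no; ¬_; does; _×-dec_; _→-dec_; ¬?)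
open import Relation.Nullary.Decidable using (toSum; dec-true; map′; True; toWitness)

-- Indicators and finite sums

-- A leaf keeps at most two constraints once its edge to a is deleted, so after a is recoloured it
-- carries at most three, and three consistent constraints always have an extension. The only danger
-- is that the new constraint is antipodal to an old one, and each old one is antipodal for exactly
-- one colour of a: this is the source of d - 1. Leaves must not be adjacent to one another, since
-- each is recoloured against the old colours of its other neighbours. An edge between two vertices
-- of degree at most 3 is no obstacle, being itself a reducible star with one leaf.
--
-- The constants come from a balance. If an excluded colour is worth 3, equality for centres with
-- two and with three surviving edges reads target = 2 unit + 3(2 + 2p) = 3 unit + 3p. This forces
-- unit = 6 + 3p and target = 18 + 12p, whose ratio is 4 - 8/(q + 3).
--
-- The bound on the chromatic number also asserts that a minimum order exists, so it has to be
-- decided whether some signed graph of a given order is a target.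

⟦_⟧ : ∀ {p} {P : Set p} → Dec P → ℕ
⟦ d ⟧ = if does d then 1 else 0

module _ {p} {P : Set p} where

  ⟦⟧-true : (d : Dec P) → P → ⟦ d ⟧ ≡ 1
  ⟦⟧-true (yes _) _ = refl
  ⟦⟧-true (no ¬p) p = ⊥-elim (¬p p)

  ⟦⟧-false : (d : Dec P) → ¬ P → ⟦ d ⟧ ≡ 0
  ⟦⟧-false (yes p) ¬p = ⊥-elim (¬p p)
  ⟦⟧-false (no _)  _  = refl

  ⟦⟧≤1 : (d : Dec P) → ⟦ d ⟧ ℕ.≤ 1
  ⟦⟧≤1 (yes _) = s≤s z≤n
  ⟦⟧≤1 (no _)  = z≤n

⟦⟧-cong : ∀ {p q} {P : Set p} {Q : Set q} (d : Dec P) (e : Dec Q) → (P → Q) → (Q → P) → ⟦ d ⟧ ≡ ⟦ e ⟧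
⟦⟧-cong (yes p) e f _ = sym (⟦⟧-true e (f p))
⟦⟧-cong (no ¬p) e _ g = sym (⟦⟧-false e (¬p ∘ g))

⟦⟧-⊎ : ∀ {p q r} {P : Set p} {Q : Set q} {R : Set r} (d : Dec P) (e : Dec Q) (f : Dec R) →
        (P → Q ⊎ R) → (Q → P) → (R → P) → (Q → ¬ R) → ⟦ d ⟧ ≡ ⟦ e ⟧ ℕ.+ ⟦ f ⟧
⟦⟧-⊎ d (yes q) (yes r) _  _  _  ¬qr = ⊥-elim (¬qr q r)
⟦⟧-⊎ d (yes q) (no _)  _  qp _  _   = ⟦⟧-true d (qp q)
⟦⟧-⊎ d (no _)  (yes r) _  _  rp _   = ⟦⟧-true d (rp r)
⟦⟧-⊎ d (no ¬q) (no ¬r) pqr _ _  _   = ⟦⟧-false d (λ p → [ ¬q , ¬r ]′ (pqr p))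

suc-≟ : ∀ {n} (i k : Fin n) → ⟦ suc i Fin.≟ suc k ⟧ ≡ ⟦ i Fin.≟ k ⟧
suc-≟ i k = ⟦⟧-cong (suc i Fin.≟ suc k) (i Fin.≟ k) Fin.suc-injective (cong suc)

-- The sums are opaque so that unification does not unfold them.
module _ where
  open import Data.Nat.Base using (_+_; _*_; _≤_)
  module Sum = SemiringSum ℕ.+-*-semiring

  opaque
    ∑ : ∀ {n} → (Fin n → ℕ) → ℕ
    ∑ = Sum.sum

    ∑-empty : (f : Fin 0 → ℕ) → ∑ f ≡ 0
    ∑-empty f = refl

    ∑-suc : ∀ {n} (f : Fin (suc n) → ℕ) → ∑ f ≡ f zero + ∑ (f ∘ suc)
    ∑-suc f = refl

    ∑-cong : ∀ {n} {f g : Fin n → ℕ} → (∀ i → f i ≡ g i) → ∑ f ≡ ∑ g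
    ∑-cong {n} {f} {g} = Sum.sum-cong-≗ {n} {f} {g}

    ∑-mono : ∀ {n} {f g : Fin n → ℕ} → (∀ i → f i ≤ g i) → ∑ f ≤ ∑ g
    ∑-mono {zero}          _   = z≤n
    ∑-mono {suc n} {f} {g} f≤g = ℕ.+-mono-≤ (f≤g zero) (∑-mono {n} {f ∘ suc} {g ∘ suc} (f≤g ∘ suc))

    ∑-mono-< : ∀ {n} {f g : Fin n → ℕ} → (∀ i → f i ≤ g i) → ∀ k → f k < g k → ∑ f < ∑ g
    ∑-mono-< {suc n} {f} {g} f≤g zero    f<g =
      ℕ.+-mono-<-≤ f<g (∑-mono {n} {f ∘ suc} {g ∘ suc} (f≤g ∘ suc))
    ∑-mono-< {suc n} {f} {g} f≤g (suc k) f<g =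
      ℕ.+-mono-≤-< (f≤g zero) (∑-mono-< {n} {f ∘ suc} {g ∘ suc} (f≤g ∘ suc) k f<g)

    ∑-term : ∀ {n} (f : Fin n → ℕ) i → f i ≤ ∑ f
    ∑-term f zero    = ℕ.m≤m+n _ _
    ∑-term f (suc i) = ℕ.≤-trans (∑-term (f ∘ suc) i) (ℕ.m≤n+m _ _)

    ∑-const : ∀ n k → ∑ {n} (λ _ → k) ≡ n * k
    ∑-const zero    k = refl
    ∑-const (suc n) k = cong (k ℕ.+_) (∑-const n k)

    ∑-zero : ∀ n → ∑ {n} (λ _ → 0) ≡ 0
    ∑-zero n = Sum.sum-replicate-zero n

    ∑-+ : ∀ {n} (f g : Fin n → ℕ) → ∑ (λ i → f i + g i) ≡ ∑ f + ∑ g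
    ∑-+ = Sum.∑-distrib-+

    ∑-swap : ∀ {m n} (f : Fin m → Fin n → ℕ) → ∑ (λ i → ∑ (f i)) ≡ ∑ (λ j → ∑ (λ i → f i j))
    ∑-swap = Sum.∑-comm

    *-∑ : ∀ {n} k (f : Fin n → ℕ) → k * ∑ f ≡ ∑ (λ i → k * f i)
    *-∑ = Sum.*-distribˡ-sum

    ∑-* : ∀ {n} k (f : Fin n → ℕ) → ∑ f * k ≡ ∑ (λ i → f i * k)
    ∑-* = Sum.*-distribʳ-sum

  -- The averaging principle by which colours and neighbours are found: no witness is constructed,
  -- only totals are compared.
  ∑-<⇒∃ : ∀ {n} (f g : Fin n → ℕ) → ∑ f < ∑ g → ∃ λ i → f i < g i
  ∑-<⇒∃ f g ∑f<∑g with Fin.any? (λ i → f i ℕ.<? g i)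
  ... | yes found = found
  ... | no  none  = ⊥-elim (ℕ.<⇒≱ ∑f<∑g (∑-mono (λ i → ℕ.≮⇒≥ (none ∘ (i ,_)))))

  ∑-single : ∀ {n} (k : Fin n) (f : Fin n → ℕ) → ∑ (λ i → ⟦ i Fin.≟ k ⟧ * f i) ≡ f k
  ∑-single {suc n} zero f = begin
    ∑ (λ i → ⟦ i Fin.≟ zero ⟧ * f i)    ≡⟨ ∑-suc _ ⟩
    f zero + 0 + ∑ {n} (λ _ → 0)        ≡⟨ cong₂ _+_ (ℕ.+-identityʳ _) (∑-zero n) ⟩
    f zero + 0                          ≡⟨ ℕ.+-identityʳ _ ⟩
    f zero                              ∎
    where open ≡-Reasoning
  ∑-single {suc n} (suc k) f = begin
    ∑ (λ i → ⟦ i Fin.≟ suc k ⟧ * f i)              ≡⟨ ∑-suc _ ⟩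
    ∑ (λ i → ⟦ suc i Fin.≟ suc k ⟧ * f (suc i))    ≡⟨ ∑-cong (λ i → cong (_* f (suc i)) (suc-≟ i k)) ⟩
    ∑ (λ i → ⟦ i Fin.≟ k ⟧ * f (suc i))            ≡⟨ ∑-single k (f ∘ suc) ⟩
    f (suc k)                                      ∎
    where open ≡-Reasoning

  ∑-δ : ∀ {n} (k : Fin n) → ∑ (λ i → ⟦ i Fin.≟ k ⟧) ≡ 1
  ∑-δ k = trans (∑-cong (λ i → sym (ℕ.*-identityʳ _))) (∑-single k (λ _ → 1))

module _ where
  module Sumᶻ = SemiringSum ℤ.+-*-semiring

  opaque
    ∑ᶻ : ∀ {n} → (Fin n → ℤ) → ℤ
    ∑ᶻ = Sumᶻ.sum

    ∑ᶻ-suc : ∀ {n} (f : Fin (suc n) → ℤ) → ∑ᶻ f ≡ f zero ℤ.+ ∑ᶻ (f ∘ suc)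
    ∑ᶻ-suc f = refl

    ∑ᶻ-cong : ∀ {n} {f g : Fin n → ℤ} → (∀ i → f i ≡ g i) → ∑ᶻ f ≡ ∑ᶻ g
    ∑ᶻ-cong {n} {f} {g} = Sumᶻ.sum-cong-≗ {n} {f} {g}

    ∑ᶻ-mono : ∀ {n} {f g : Fin n → ℤ} → (∀ i → f i ℤ.≤ g i) → ∑ᶻ f ℤ.≤ ∑ᶻ g
    ∑ᶻ-mono {zero}          _   = ℤ.≤-refl
    ∑ᶻ-mono {suc n} {f} {g} f≤g = ℤ.+-mono-≤ (f≤g zero) (∑ᶻ-mono {n} {f ∘ suc} {g ∘ suc} (f≤g ∘ suc))

    ∑ᶻ-zero : ∀ n → ∑ᶻ {n} (λ _ → 0ℤ) ≡ 0ℤ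
    ∑ᶻ-zero n = Sumᶻ.sum-replicate-zero n

    ∑ᶻ-+ : ∀ {n} (f g : Fin n → ℤ) → ∑ᶻ (λ i → f i ℤ.+ g i) ≡ ∑ᶻ f ℤ.+ ∑ᶻ g
    ∑ᶻ-+ = Sumᶻ.∑-distrib-+

    ∑ᶻ-swap : ∀ {m n} (f : Fin m → Fin n → ℤ) → ∑ᶻ (λ i → ∑ᶻ (f i)) ≡ ∑ᶻ (λ j → ∑ᶻ (λ i → f i j))
    ∑ᶻ-swap = Sumᶻ.∑-comm

    *-∑ᶻ : ∀ {n} k (f : Fin n → ℤ) → k ℤ.* ∑ᶻ f ≡ ∑ᶻ (λ i → k ℤ.* f i)
    *-∑ᶻ = Sumᶻ.*-distribˡ-sum

    ∑ᶻ-* : ∀ {n} k (f : Fin n → ℤ) → ∑ᶻ f ℤ.* k ≡ ∑ᶻ (λ i → f i ℤ.* k)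
    ∑ᶻ-* = Sumᶻ.*-distribʳ-sum

    ∑ᶻ-permute : ∀ {n} (f : Fin n → ℤ) (π : Permutation.Permutation n n) →
                 ∑ᶻ f ≡ ∑ᶻ (λ i → f (π Permutation.⟨$⟩ʳ i))
    ∑ᶻ-permute = Sumᶻ.sum-permute

  opaque
    unfolding ∑ ∑ᶻ

    pos-∑ : ∀ {n} (f : Fin n → ℕ) → + ∑ f ≡ ∑ᶻ (λ i → + f i)
    pos-∑ {zero}  f = refl
    pos-∑ {suc n} f = trans (ℤ.pos-+ (f zero) _) (cong (λ z → + f zero ℤ.+ z) (pos-∑ (f ∘ suc)))

  ∑ᶻ-single : ∀ {n} (k : Fin n) (f : Fin n → ℤ) → ∑ᶻ (λ i → + ⟦ i Fin.≟ k ⟧ ℤ.* f i) ≡ f k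
  ∑ᶻ-single {suc n} zero f = begin
    ∑ᶻ (λ i → + ⟦ i Fin.≟ zero ⟧ ℤ.* f i)                      ≡⟨ ∑ᶻ-suc _ ⟩
    1ℤ ℤ.* f zero ℤ.+ ∑ᶻ {n} (λ i → 0ℤ ℤ.* f (suc i))
      ≡⟨ cong₂ ℤ._+_ (ℤ.*-identityˡ (f zero))
                     (trans (∑ᶻ-cong (λ i → ℤ.*-zeroˡ (f (suc i)))) (∑ᶻ-zero n)) ⟩
    f zero ℤ.+ 0ℤ                                              ≡⟨ ℤ.+-identityʳ _ ⟩
    f zero                                                     ∎
    where open ≡-Reasoning
  ∑ᶻ-single {suc n} (suc k) f = begin
    ∑ᶻ (λ i → + ⟦ i Fin.≟ suc k ⟧ ℤ.* f i)                    ≡⟨ ∑ᶻ-suc _ ⟩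
    0ℤ ℤ.* f zero ℤ.+ ∑ᶻ (λ i → + ⟦ suc i Fin.≟ suc k ⟧ ℤ.* f (suc i))
      ≡⟨ cong₂ ℤ._+_ (ℤ.*-zeroˡ (f zero))
                     (∑ᶻ-cong (λ i → cong (λ b → + b ℤ.* f (suc i)) (suc-≟ i k))) ⟩
    0ℤ ℤ.+ ∑ᶻ (λ i → + ⟦ i Fin.≟ k ⟧ ℤ.* f (suc i))           ≡⟨ ℤ.+-identityˡ _ ⟩
    ∑ᶻ (λ i → + ⟦ i Fin.≟ k ⟧ ℤ.* f (suc i))                  ≡⟨ ∑ᶻ-single k (f ∘ suc) ⟩
    f (suc k)                                                 ∎
    where open ≡-Reasoning

-- The quadratic character

module ℤRing = RingProperties ℤ.+-*-ring

Paired-even : ∀ {A : Set} {f : A → A} {xs} → Paired f xs → ∃ λ k → length xs ≡ 2 ℕ.* k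
Paired-even done = 0 , refl
Paired-even (pair x xs↭ p) with k , eq ← Paired-even p =
  suc k , trans (↭-length xs↭) (trans (cong (2 ℕ.+_) eq) (sym (ℕ.*-suc 2 k)))

module _ {q : ℕ} (F : FiniteField q) (q≡1 : q % 4 ≡ 1) where

  open FiniteField F
  open CommutativeRing commutativeRing
    using (ring; commutativeSemiring; *-comm; *-assoc; *-identityˡ; zeroˡ; zeroʳ; distribʳ
          ; +-assoc; +-comm; +-identityˡ; +-identityʳ; +-congˡ; -‿inverseˡ; -‿inverseʳ)
  open RingProperties ring
    using (-‿involutive; -‿distribˡ-*; -‿distribʳ-*; -‿anti-homo-+; +-inverseʳ-unique; +-cancelˡ)
  open NaturalCoefficients commutativeSemiring using (solve; _:=_; _:+_; _:*_)
  open ≡-Reasoning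

  -- In characteristic 2 the translation by `1#` would be an involution without fixed points,
  -- pairing up all elements of the field, but `q` is odd.
  1≢-1 : 1# ≢ - 1#
  1≢-1 1≡-1 = ℕ.even≢odd (proj₁ even) (q ℕ./ 4 ℕ.* 2) (begin
      2 ℕ.* proj₁ even                ≡⟨ proj₂ even ⟨
      length (allElements F)          ≡⟨ trans (length-map element (allFin q)) (length-tabulate {n = q} id) ⟩
      q                               ≡⟨ m≡m%n+[m/n]*n q 4 ⟩
      q % 4 ℕ.+ q ℕ./ 4 ℕ.* 4         ≡⟨ cong₂ ℕ._+_ q≡1 (sym (ℕ.*-assoc (q ℕ./ 4) 2 2)) ⟩
      suc (q ℕ./ 4 ℕ.* 2 ℕ.* 2)       ≡⟨ cong suc (ℕ.*-comm (q ℕ./ 4 ℕ.* 2) 2) ⟩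
      suc (2 ℕ.* (q ℕ./ 4 ℕ.* 2))     ∎)
    where
    x+1≢x : ∀ {x} → x + 1# ≢ x
    x+1≢x {x} eq = 0≢1 (sym (+-cancelˡ x 1# 0# (trans eq (sym (+-identityʳ x)))))

    x+1+1≡x : ∀ {x} → x + 1# + 1# ≡ x
    x+1+1≡x {x} = begin
      x + 1# + 1#       ≡⟨ +-assoc x 1# 1# ⟩
      x + (1# + 1#)     ≡⟨ cong (λ a → x + (1# + a)) 1≡-1 ⟩
      x + (1# + - 1#)   ≡⟨ +-congˡ (-‿inverseʳ 1#) ⟩
      x + 0#            ≡⟨ +-identityʳ x ⟩
      x                 ∎

    even : ∃ λ k → length (allElements F) ≡ 2 ℕ.* k
    even = Paired-even (paired (_+ 1#) _ (allElements F) ℕ.≤-refl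
      (allElements-unique F) (λ _ → ∈-allElements F _) (λ _ → x+1≢x) (λ _ → x+1+1≡x))

  x+x≢0 : ∀ {x} → x ≢ 0# → x + x ≢ 0#
  x+x≢0 x≢0 x+x≡0 = -x≢x F 1≢-1 x≢0 (sym (+-inverseʳ-unique _ _ x+x≡0))

  ∑F : (Carrier → ℤ) → ℤ
  ∑F g = ∑ᶻ (g ∘ element)

  ∑F-single : ∀ c (g : Carrier → ℤ) → ∑F (λ x → + ⟦ x ≟ c ⟧ ℤ.* g x) ≡ g c
  ∑F-single c g = begin
    ∑F (λ x → + ⟦ x ≟ c ⟧ ℤ.* g x)
      ≡⟨ ∑ᶻ-cong (λ i → cong (λ b → + b ℤ.* g (element i))
           (⟦⟧-cong (element i ≟ c) (i Fin.≟ index c)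
              (λ eq → element-injective (trans eq (sym (element-index c))))
              (λ eq → trans (cong element eq) (element-index c)))) ⟩
    ∑ᶻ (λ i → + ⟦ i Fin.≟ index c ⟧ ℤ.* g (element i))
      ≡⟨ ∑ᶻ-single (index c) (g ∘ element) ⟩
    g (element (index c))
      ≡⟨ cong g (element-index c) ⟩
    g c ∎

  ∑F-δ : ∀ c → ∑F (λ x → + ⟦ x ≟ c ⟧) ≡ 1ℤ
  ∑F-δ c = trans (∑ᶻ-cong (λ i → sym (ℤ.*-identityʳ _))) (∑F-single c (λ _ → 1ℤ))

  ∑F-1 : ∑F (λ _ → 1ℤ) ≡ + q
  ∑F-1 = trans (sym (pos-∑ {q} (λ _ → 1))) (cong +_ (trans (∑-const q 1) (ℕ.*-identityʳ q)))

  ∑F-shift : ∀ c (g : Carrier → ℤ) → ∑F (λ x → g (x + c)) ≡ ∑F g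
  ∑F-shift c g = sym (trans (∑ᶻ-permute (g ∘ element) translation)
                            (∑ᶻ-cong (λ i → cong g (element-index _))))
    where
    cancel : ∀ {a b x} → a + b ≡ 0# → x + a + b ≡ x
    cancel {x = x} a+b≡0 = trans (+-assoc x _ _) (trans (+-congˡ a+b≡0) (+-identityʳ x))

    translate-cancel : ∀ {a b} → a + b ≡ 0# →
      ∀ i → index (element (index (element i + a)) + b) ≡ i
    translate-cancel {a} {b} a+b≡0 i = element-injective (begin
      element (index (element (index (element i + a)) + b))  ≡⟨ element-index _ ⟩
      element (index (element i + a)) + b                    ≡⟨ cong (_+ b) (element-index _) ⟩
      element i + a + b                                      ≡⟨ cancel a+b≡0 ⟩
      element i                                              ∎)

    translation : Permutation.Permutation q q
    translation = Permutation.permutation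
      (λ i → index (element i + c)) (λ i → index (element i + - c))
      (translate-cancel (-‿inverseˡ c)) (translate-cancel (-‿inverseʳ c))

  χ : Carrier → ℤ
  χ z with z ≟ 0# | isSquare? z
  ... | yes _ | _     = 0ℤ
  ... | no  _ | yes _ = 1ℤ
  ... | no  _ | no  _ = -1ℤ

  roots : Carrier → ℤ
  roots z = ∑F (λ y → + ⟦ (y * y) ≟ z ⟧)

  equalSquares : ∀ y w → y * y ≡ w * w → y ≢ w → y ≡ - w
  equalSquares y w yy≡ww y≢w = +-inverseʳ-unique w y (trans (+-comm w y) (cancelˡ F y-w≢0 factored))
    where
    y-w≢0 : y + - w ≢ 0#
    y-w≢0 eq = y≢w (trans (+-inverseʳ-unique (- w) y (trans (+-comm (- w) y) eq)) (-‿involutive w))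

    factored : (y + - w) * (y + w) ≡ 0#
    factored = begin
      (y + - w) * (y + w)
        ≡⟨ solve 3 (λ y w w′ → (y :+ w′) :* (y :+ w) := y :* y :+ w′ :* w :+ (w :+ w′) :* y) refl y w (- w) ⟩
      y * y + - w * w + (w + - w) * y
        ≡⟨ cong₂ _+_ (cong (_+ - w * w) yy≡ww) (cong (_* y) (-‿inverseʳ w)) ⟩
      w * w + - w * w + 0# * y
        ≡⟨ cong₂ _+_ (sym (distribʳ w w (- w))) (zeroˡ y) ⟩
      (w + - w) * w + 0#
        ≡⟨ trans (+-identityʳ _) (trans (cong (_* w) (-‿inverseʳ w)) (zeroˡ w)) ⟩
      0# ∎

  -- This takes the place of the multiplicativity of `χ`: character sums become numbers of solutions
  -- of quadratic equations, which are counted by interchanging sums.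
  roots≡1+χ : ∀ z → roots z ≡ 1ℤ ℤ.+ χ z
  roots≡1+χ z with z ≟ 0# | isSquare? z
  ... | yes refl | _ = trans
        (∑ᶻ-cong (λ i → cong +_ (⟦⟧-cong ((element i * element i) ≟ 0#) (element i ≟ 0#) yy≡0⇒y≡0
                                   (λ y≡0 → trans (cong (_* element i) y≡0) (zeroˡ _)))))
        (∑F-δ 0#)
    where
    yy≡0⇒y≡0 : ∀ {y} → y * y ≡ 0# → y ≡ 0#
    yy≡0⇒y≡0 {y} eq with y ≟ 0#
    ... | yes y≡0 = y≡0
    ... | no  y≢0 = cancelˡ F y≢0 eq
  ... | no z≢0 | yes (w , refl) = begin
      ∑F (λ y → + ⟦ (y * y) ≟ (w * w) ⟧)                   ≡⟨ ∑ᶻ-cong (λ i → two-roots (element i)) ⟩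
      ∑F (λ y → + ⟦ y ≟ w ⟧ ℤ.+ + ⟦ y ≟ (- w) ⟧)           ≡⟨ ∑ᶻ-+ _ _ ⟩
      ∑F (λ y → + ⟦ y ≟ w ⟧) ℤ.+ ∑F (λ y → + ⟦ y ≟ (- w) ⟧) ≡⟨ cong₂ ℤ._+_ (∑F-δ w) (∑F-δ (- w)) ⟩
      + 2                                                  ∎
    where
    w≢0 : w ≢ 0#
    w≢0 w≡0 = z≢0 (trans (cong (_* w) w≡0) (zeroˡ w))

    two-roots : ∀ y → + ⟦ (y * y) ≟ (w * w) ⟧ ≡ + ⟦ y ≟ w ⟧ ℤ.+ + ⟦ y ≟ (- w) ⟧
    two-roots y = cong +_ (⟦⟧-⊎ ((y * y) ≟ (w * w)) (y ≟ w) (y ≟ (- w))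
      (λ eq → [ inj₁ , inj₂ ∘ equalSquares y w eq ]′ (toSum (y ≟ w)))
      (λ y≡w → cong₂ _*_ y≡w y≡w)
      (λ y≡-w → trans (cong₂ _*_ y≡-w y≡-w) -w*-w≡w*w)
      (λ y≡w y≡-w → -x≢x F 1≢-1 w≢0 (trans (sym y≡-w) y≡w)))
      where
      -w*-w≡w*w : - w * - w ≡ w * w
      -w*-w≡w*w = trans (sym (-‿distribˡ-* w (- w)))
        (trans (cong -_ (sym (-‿distribʳ-* w w))) (-‿involutive (w * w)))
  ... | no _ | no ¬sq = trans
        (∑ᶻ-cong (λ i → cong +_ (⟦⟧-false ((element i * element i) ≟ z) (λ eq → ¬sq (element i , sym eq)))))
        (∑ᶻ-zero q)

  -- Every `y` is a root of exactly one `z`, so the root counts add up to `q`, which the constant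
  -- term of `1 + χ` already accounts for.
  ∑χ≡0 : ∑F χ ≡ 0ℤ
  ∑χ≡0 = ℤRing.+-identityʳ-unique (+ q) _ (begin
    + q ℤ.+ ∑F χ                                    ≡⟨ cong (ℤ._+ ∑F χ) ∑F-1 ⟨
    ∑F (λ _ → 1ℤ) ℤ.+ ∑F χ                          ≡⟨ ∑ᶻ-+ _ _ ⟨
    ∑F (λ z → 1ℤ ℤ.+ χ z)                           ≡⟨ ∑ᶻ-cong (λ i → roots≡1+χ (element i)) ⟨
    ∑F roots                                        ≡⟨ ∑ᶻ-swap _ ⟩
    ∑F (λ y → ∑F (λ z → + ⟦ (y * y) ≟ z ⟧))         ≡⟨ ∑ᶻ-cong (λ i → trans
                                                         (∑ᶻ-cong (λ j → cong +_ (⟦⟧-cong (_ ≟ _) (_ ≟ _) sym sym)))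
                                                         (∑F-δ (element i * element i))) ⟩
    ∑F (λ _ → 1ℤ)                                   ≡⟨ ∑F-1 ⟩
    + q                                             ∎)

  -- The pairs (u , v) with v² = u² + c are counted by s = v - u.
  module _ {c : Carrier} (c≢0 : c ≢ 0#) where

    private
      -- The squares of `u` cancel and leave the linear equation `(s + s) * u = c - s * s`. It has
      -- one solution if `s` is nonzero and none otherwise, because `c` is nonzero.
      differenceOfSquares : ∀ s → ∑F (λ u → + ⟦ ((s + u) * (s + u)) ≟ (u * u + c) ⟧) ≡ 1ℤ ℤ.- + ⟦ s ≟ 0# ⟧
      differenceOfSquares s with s ≟ 0#
      ... | yes refl = trans
          (∑ᶻ-cong (λ i → cong +_ (⟦⟧-false (((0# + element i) * (0# + element i)) ≟ (element i * element i + c))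
            (λ eq → c≢0 (no-root (element i) eq)))))
          (trans (∑ᶻ-zero q) (cong (λ b → 1ℤ ℤ.- + b) (sym (⟦⟧-true (0# ≟ 0#) refl))))
        where
        no-root : ∀ u → (0# + u) * (0# + u) ≡ u * u + c → c ≡ 0#
        no-root u eq = +-cancelˡ (u * u) c 0# (begin
          u * u + c             ≡⟨ eq ⟨
          (0# + u) * (0# + u)   ≡⟨ cong₂ _*_ (+-identityˡ u) (+-identityˡ u) ⟩
          u * u                 ≡⟨ +-identityʳ _ ⟨
          u * u + 0#            ∎)
      ... | no s≢0 = trans
          (∑ᶻ-cong (λ i → cong +_ (⟦⟧-cong (_ ≟ _) (element i ≟ u₀) (only-root (element i)) (is-root (element i)))))
          (trans (∑F-δ u₀) (cong (λ b → 1ℤ ℤ.- + b) (sym (⟦⟧-false (s ≟ 0#) s≢0))))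
        where
        u₀ : Carrier
        u₀ = (s + s) ⁻¹ * (c + - (s * s))

        expand : ∀ u → (s + u) * (s + u) ≡ u * u + (s * s + (s + s) * u)
        expand = solve 2 (λ s u → (s :+ u) :* (s :+ u) := u :* u :+ (s :* s :+ (s :+ s) :* u)) refl s

        *-⁻¹-cancel : ∀ x → (s + s) * ((s + s) ⁻¹ * x) ≡ x
        *-⁻¹-cancel x = trans (sym (*-assoc _ _ x))
          (trans (cong (_* x) (inverseʳ (s + s) (x+x≢0 s≢0))) (*-identityˡ x))

        only-root : ∀ u → (s + u) * (s + u) ≡ u * u + c → u ≡ u₀
        only-root u eq = begin
          u                                     ≡⟨ *-identityˡ u ⟨
          1# * u                                ≡⟨ cong (_* u) (trans (*-comm _ _) (inverseʳ (s + s) (x+x≢0 s≢0))) ⟨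
          (s + s) ⁻¹ * (s + s) * u              ≡⟨ *-assoc _ _ u ⟩
          (s + s) ⁻¹ * ((s + s) * u)            ≡⟨ cong ((s + s) ⁻¹ *_) linear ⟩
          u₀                                    ∎
          where
          linear : (s + s) * u ≡ c + - (s * s)
          linear = begin
            (s + s) * u                             ≡⟨ +-identityʳ _ ⟨
            (s + s) * u + 0#                        ≡⟨ +-congˡ (-‿inverseʳ (s * s)) ⟨
            (s + s) * u + (s * s + - (s * s))       ≡⟨ +-assoc _ _ _ ⟨
            (s + s) * u + s * s + - (s * s)         ≡⟨ cong (_+ - (s * s)) (+-comm _ _) ⟩
            s * s + (s + s) * u + - (s * s)         ≡⟨ cong (_+ - (s * s))
                                                        (+-cancelˡ (u * u) _ _ (trans (sym (expand u)) eq)) ⟩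
            c + - (s * s)                           ∎

        is-root : ∀ u → u ≡ u₀ → (s + u) * (s + u) ≡ u * u + c
        is-root u refl = begin
          (s + u) * (s + u)                   ≡⟨ expand u ⟩
          u * u + (s * s + (s + s) * u)       ≡⟨ cong (λ a → u * u + (s * s + a)) (*-⁻¹-cancel _) ⟩
          u * u + (s * s + (c + - (s * s)))   ≡⟨ cong (λ a → u * u + (s * s + a)) (+-comm c _) ⟩
          u * u + (s * s + (- (s * s) + c))   ≡⟨ +-congˡ (+-assoc _ _ _) ⟨
          u * u + (s * s + - (s * s) + c)     ≡⟨ cong (λ a → u * u + (a + c)) (-‿inverseʳ _) ⟩
          u * u + (0# + c)                    ≡⟨ +-congˡ (+-identityˡ c) ⟩
          u * u + c                           ∎

      ∑roots*roots : ∑F (λ x → roots x ℤ.* roots (x + c)) ≡ + q ℤ.- 1ℤ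
      ∑roots*roots = begin
        ∑F (λ x → roots x ℤ.* roots (x + c))
          ≡⟨ ∑ᶻ-cong (λ i → ∑ᶻ-* (roots (element i + c)) _) ⟩
        ∑F (λ x → ∑F (λ u → + ⟦ (u * u) ≟ x ⟧ ℤ.* roots (x + c)))
          ≡⟨ ∑ᶻ-swap _ ⟩
        ∑F (λ u → ∑F (λ x → + ⟦ (u * u) ≟ x ⟧ ℤ.* roots (x + c)))
          ≡⟨ ∑ᶻ-cong (λ i → trans
               (∑ᶻ-cong (λ j → cong (λ b → + b ℤ.* roots (element j + c)) (⟦⟧-cong (_ ≟ _) (_ ≟ _) sym sym)))
               (∑F-single (element i * element i) (λ x → roots (x + c)))) ⟩
        ∑F (λ u → roots (u * u + c))
          -- For fixed `u` the substitution `v = s + u` is a translation, so summing over `s` is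
          -- summing over `v`.
          ≡⟨ ∑ᶻ-cong (λ i → ∑F-shift (element i) (λ v → + ⟦ (v * v) ≟ (element i * element i + c) ⟧)) ⟨
        ∑F (λ u → ∑F (λ s → + ⟦ ((s + u) * (s + u)) ≟ (u * u + c) ⟧))
          ≡⟨ ∑ᶻ-swap _ ⟩
        ∑F (λ s → ∑F (λ u → + ⟦ ((s + u) * (s + u)) ≟ (u * u + c) ⟧))
          ≡⟨ ∑ᶻ-cong (λ i → differenceOfSquares (element i)) ⟩
        ∑F (λ s → 1ℤ ℤ.+ ℤ.- + ⟦ s ≟ 0# ⟧)
          ≡⟨ ∑ᶻ-+ _ _ ⟩
        ∑F (λ _ → 1ℤ) ℤ.+ ∑F (λ s → ℤ.- + ⟦ s ≟ 0# ⟧)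
          ≡⟨ cong₂ ℤ._+_ ∑F-1 (trans (∑ᶻ-cong (λ i → sym (ℤ.-1*i≡-i _)))
               (trans (sym (*-∑ᶻ -1ℤ _)) (cong (-1ℤ ℤ.*_) (∑F-δ 0#)))) ⟩
        + q ℤ.- 1ℤ ∎

    -- Expanding `(1 + χ x)(1 + χ (x + c))` gives `q`, two vanishing linear sums and the sum in
    -- question, while the product of root counts totals `q - 1`.
    ∑χχ≡-1 : ∑F (λ x → χ x ℤ.* χ (x + c)) ≡ -1ℤ
    ∑χχ≡-1 = ℤRing.+-cancelˡ (+ q) _ _ (begin
      + q ℤ.+ ∑F χχ
        ≡⟨ drop-zeros (+ q) (∑F χχ) ⟨
      + q ℤ.+ 0ℤ ℤ.+ 0ℤ ℤ.+ ∑F χχ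
        ≡⟨ cong₂ (λ a b → + q ℤ.+ a ℤ.+ b ℤ.+ ∑F χχ) ∑χ≡0 (trans (∑F-shift c χ) ∑χ≡0) ⟨
      + q ℤ.+ ∑F χ ℤ.+ ∑F (λ x → χ (x + c)) ℤ.+ ∑F χχ
        ≡⟨ cong (λ a → a ℤ.+ ∑F χ ℤ.+ ∑F (λ x → χ (x + c)) ℤ.+ ∑F χχ) ∑F-1 ⟨
      ∑F (λ _ → 1ℤ) ℤ.+ ∑F χ ℤ.+ ∑F (λ x → χ (x + c)) ℤ.+ ∑F χχ
        ≡⟨ cong (λ a → a ℤ.+ ∑F (λ x → χ (x + c)) ℤ.+ ∑F χχ) (∑ᶻ-+ _ _) ⟨
      ∑F (λ x → 1ℤ ℤ.+ χ x) ℤ.+ ∑F (λ x → χ (x + c)) ℤ.+ ∑F χχ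
        ≡⟨ cong (λ a → a ℤ.+ ∑F χχ) (∑ᶻ-+ _ _) ⟨
      ∑F (λ x → 1ℤ ℤ.+ χ x ℤ.+ χ (x + c)) ℤ.+ ∑F χχ
        ≡⟨ ∑ᶻ-+ _ _ ⟨
      ∑F (λ x → 1ℤ ℤ.+ χ x ℤ.+ χ (x + c) ℤ.+ χχ x)
        ≡⟨ ∑ᶻ-cong (λ i → sym (trans (cong₂ ℤ._*_ (roots≡1+χ _) (roots≡1+χ _))
                                     (product-expand (χ (element i)) (χ (element i + c))))) ⟩
      ∑F (λ x → roots x ℤ.* roots (x + c))
        ≡⟨ ∑roots*roots ⟩
      + q ℤ.+ -1ℤ ∎)
      where
      χχ : Carrier → ℤ
      χχ x = χ x ℤ.* χ (x + c)

      drop-zeros : ∀ a b → a ℤ.+ 0ℤ ℤ.+ 0ℤ ℤ.+ b ≡ a ℤ.+ b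
      drop-zeros = ℤSolver.solve-∀

      product-expand : ∀ a b → (1ℤ ℤ.+ a) ℤ.* (1ℤ ℤ.+ b) ≡ 1ℤ ℤ.+ a ℤ.+ b ℤ.+ a ℤ.* b
      product-expand = ℤSolver.solve-∀

  ∑χ-χ-≡-1 : ∀ {a b} → a ≢ b → ∑F (λ x → χ (x - a) ℤ.* χ (x - b)) ≡ -1ℤ
  ∑χ-χ-≡-1 {a} {b} a≢b = begin
    ∑F (λ x → χ (x - a) ℤ.* χ (x - b))
      ≡⟨ ∑ᶻ-cong (λ i → cong (λ y → χ (element i - a) ℤ.* χ y) (sym (telescope (element i)))) ⟩
    ∑F (λ x → χ (x - a) ℤ.* χ (x - a + (a - b)))
      ≡⟨ ∑F-shift (- a) (λ x → χ x ℤ.* χ (x + (a - b))) ⟩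
    ∑F (λ x → χ x ℤ.* χ (x + (a - b)))
      ≡⟨ ∑χχ≡-1 a-b≢0 ⟩
    -1ℤ ∎
    where
    telescope : ∀ x → x - a + (a - b) ≡ x - b
    telescope x = begin
      x + - a + (a + - b)     ≡⟨ +-assoc x (- a) _ ⟩
      x + (- a + (a + - b))   ≡⟨ +-congˡ (+-assoc (- a) a (- b)) ⟨
      x + (- a + a + - b)     ≡⟨ cong (λ y → x + (y + - b)) (-‿inverseˡ a) ⟩
      x + (0# + - b)          ≡⟨ +-congˡ (+-identityˡ (- b)) ⟩
      x + - b                 ∎

    a-b≢0 : a - b ≢ 0#
    a-b≢0 eq = a≢b (trans (+-inverseʳ-unique (- b) a (trans (+-comm (- b) a) eq)) (-‿involutive b))

-- Extensions of constraints to a conference graph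

⟦⟧-idem : ∀ {p} {P : Set p} (d : Dec P) k → ⟦ d ⟧ ℕ.* (⟦ d ⟧ ℕ.* k) ≡ ⟦ d ⟧ ℕ.* k
⟦⟧-idem (yes _) k = ℕ.*-identityˡ _
⟦⟧-idem (no _)  k = refl

⟦⟧-positive : ∀ {p} {P : Set p} (d : Dec P) {k} → 0 < ⟦ d ⟧ ℕ.* k → P × 0 < k
⟦⟧-positive (yes p) {k} 0<k = p , subst (0 <_) (ℕ.+-identityʳ k) 0<k

by-decision : ∀ {a} {A : Set a} (d : Dec A) {_ : True d} → A
by-decision d {t} = toWitness t

_≟ˢ_ : DecidableEquality (Maybe Sign)
_≟ˢ_ = Maybe.≡-dec Sign._≟_

∀-Sign? : ∀ {P : Sign → Set} → (∀ s → Dec (P s)) → Dec (∀ s → P s)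
∀-Sign? P? = map′ (λ { (p , m) Sign.+ → p ; (p , m) Sign.- → m }) (λ f → f Sign.+ , f Sign.-)
                  (P? Sign.+ ×-dec P? Sign.-)

∀-MaybeSign? : ∀ {P : Maybe Sign → Set} → (∀ k → Dec (P k)) → Dec (∀ k → P k)
∀-MaybeSign? P? = map′ (λ { (n , j) nothing → n ; (n , j) (just s) → j s }) (λ f → f nothing , f ∘ just)
                       (P? nothing ×-dec ∀-Sign? (P? ∘ just))

value : Maybe Sign → ℤ
value nothing         = 0ℤ
value (just Sign.+)   = 1ℤ
value (just Sign.-)   = -1ℤ

-- The vertices of the double cover of H, in which switching a vertex
-- amounts to exchanging it with its antipode.
module Colours {m : ℕ} (H : SignedGraph m) where
  open import Data.Nat.Base using (_+_; _*_; _≤_)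

  Colour : Set
  Colour = Fin m × Sign

  antipode : Colour → Colour
  antipode (i , s) = i , opposite s

  infixr 8 _⊙_
  _⊙_ : Sign → Colour → Colour
  s ⊙ (i , t) = i , s Sign.* t

  infix 4 _~_ _~?_ _≟ᶜ_

  -- The positive edges of the double cover: the edge of `H` between the two underlying vertices
  -- becomes positive when each end is switched according to the sign of its colour.
  record _~_ (x y : Colour) : Set where
    constructor agree
    field
      agreement : sign H (proj₁ x) (proj₁ y) ≡ just (proj₂ x Sign.* proj₂ y)
  open _~_ public

  _~?_ : ∀ x y → Dec (x ~ y)
  (i , s) ~? (j , t) = map′ agree agreement (sign H i j ≟ˢ just (s Sign.* t))

  _≟ᶜ_ : DecidableEquality Colour
  _≟ᶜ_ = Product.≡-dec Fin._≟_ Sign._≟_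

  ⊙-~ : ∀ s {x y} → x ~ s ⊙ y → y ~ s ⊙ x
  ⊙-~ s {i , t} {j , u} (agree ij) = agree (trans (symmetric H j i) (trans ij (cong just (swap t s u))))
    where
    swap : ∀ t s u → t Sign.* (s Sign.* u) ≡ u Sign.* (s Sign.* t)
    swap = by-decision (∀-Sign? λ t → ∀-Sign? λ s → ∀-Sign? λ u → _ Sign.≟ _)

  ~⇒≢antipode : ∀ {x c d} → x ~ c → x ~ d → c ≢ antipode d
  ~⇒≢antipode {_ , t} {_} {_ , s} (agree lc) (agree ld) refl =
    absurd t s (Maybe.just-injective (trans (sym lc) ld))
    where
    absurd : ∀ t s → ¬ (t Sign.* opposite s ≡ t Sign.* s)
    absurd = by-decision (∀-Sign? λ t → ∀-Sign? λ s → ¬? (_ Sign.≟ _))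

  ≢antipode : ∀ {c d} → c ≢ antipode d → c ≡ d ⊎ proj₁ c ≢ proj₁ d
  ≢antipode {i , s} {j , t} c≢ with i Fin.≟ j
  ... | no i≢j   = inj₂ i≢j
  ... | yes refl = inj₁ (cong (i ,_) (same s t (c≢ ∘ cong (i ,_))))
    where
    same : ∀ s t → s ≢ opposite t → s ≡ t
    same = by-decision (∀-Sign? λ s → ∀-Sign? λ t → ¬? (_ Sign.≟ _) →-dec (_ Sign.≟ _))

  opaque
    ∑ᶜ : (Colour → ℕ) → ℕ
    ∑ᶜ f = ∑ (λ l → f (l , Sign.+) + f (l , Sign.-))

    ∑ᶜ≡∑ : ∀ f → ∑ᶜ f ≡ ∑ (λ l → f (l , Sign.+) + f (l , Sign.-))
    ∑ᶜ≡∑ f = refl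

    ∑ᶜ-mono : ∀ {f g : Colour → ℕ} → (∀ x → f x ≤ g x) → ∑ᶜ f ≤ ∑ᶜ g
    ∑ᶜ-mono f≤g = ∑-mono (λ l → ℕ.+-mono-≤ (f≤g (l , Sign.+)) (f≤g (l , Sign.-)))

    ∑ᶜ-term : ∀ (f : Colour → ℕ) x → f x ≤ ∑ᶜ f
    ∑ᶜ-term f (l , Sign.+) = ℕ.≤-trans (ℕ.m≤m+n _ _) (∑-term _ l)
    ∑ᶜ-term f (l , Sign.-) = ℕ.≤-trans (ℕ.m≤n+m _ (f (l , Sign.+))) (∑-term _ l)

    ∑ᶜ-<⇒∃ : ∀ (f g : Colour → ℕ) → ∑ᶜ f < ∑ᶜ g → ∃ λ x → f x < g x
    ∑ᶜ-<⇒∃ f g f<g with l , fl<gl ← ∑-<⇒∃ _ _ f<g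
      with f (l , Sign.+) ℕ.<? g (l , Sign.+) | f (l , Sign.-) ℕ.<? g (l , Sign.-)
    ... | yes < | _     = _ , <
    ... | no  _ | yes < = _ , <
    ... | no ≮₊ | no ≮₋ = ⊥-elim (ℕ.<⇒≱ fl<gl (ℕ.+-mono-≤ (ℕ.≮⇒≥ ≮₊) (ℕ.≮⇒≥ ≮₋)))

    ∑ᶜ-+ : ∀ f g → ∑ᶜ (λ x → f x + g x) ≡ ∑ᶜ f + ∑ᶜ g
    ∑ᶜ-+ f g = trans (∑-cong (λ l → interchange (f (l , Sign.+)) (g (l , Sign.+)) (f (l , Sign.-)) (g (l , Sign.-))))
                     (∑-+ _ _)
      where
      interchange : ∀ a b c d → a + b + (c + d) ≡ a + c + (b + d)
      interchange = ℕSolver.solve-∀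

    ∑ᶜ-0 : ∑ᶜ (λ _ → 0) ≡ 0
    ∑ᶜ-0 = ∑-zero m

    ∑ᶜ-∑-swap : ∀ {n} (f : Fin n → Colour → ℕ) → ∑ᶜ (λ x → ∑ (λ w → f w x)) ≡ ∑ (λ w → ∑ᶜ (f w))
    ∑ᶜ-∑-swap f = trans (∑-cong (λ l → sym (∑-+ _ _))) (∑-swap _)

  extends : List Colour → Colour → ℕ
  extends []      x = 1
  extends (c ∷ L) x = ⟦ x ~? c ⟧ * extends L x

  extends⁺ : ∀ {L x} → All (x ~_) L → extends L x ≡ 1
  extends⁺ []                      = refl
  extends⁺ {c ∷ L} {x} (x~c ∷ x~L) = cong₂ _*_ (⟦⟧-true (x ~? c) x~c) (extends⁺ {L} {x} x~L)

  extends⁻ : ∀ L {x} → 0 < extends L x → All (x ~_) L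
  extends⁻ []      _ = []
  extends⁻ (c ∷ L) {x} 0<e with x~c , 0<rest ← ⟦⟧-positive (x ~? c) 0<e = x~c ∷ extends⁻ L 0<rest

  extends≤1 : ∀ L x → extends L x ≤ 1
  extends≤1 []      x = s≤s z≤n
  extends≤1 (c ∷ L) x = ℕ.*-mono-≤ (⟦⟧≤1 (x ~? c)) (extends≤1 L x)

  extensions : List Colour → ℕ
  extensions L = ∑ᶜ (extends L)

  -- Equal constraints are allowed, since two neighbours may impose the same colour; only antipodal
  -- ones contradict each other outright.
  Consistent : List Colour → Set
  Consistent = AllPairs (λ c d → c ≢ antipode d)

  ~⇒Consistent : ∀ {x L} → All (x ~_) L → Consistent L
  ~⇒Consistent []                        = []
  ~⇒Consistent {x} {c ∷ _} (x~c ∷ x~L) =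
    All.map (λ {d} → ~⇒≢antipode {x} {c} {d} x~c) x~L ∷ ~⇒Consistent {x} x~L

-- A lower bound on the number of extensions of r consistent constraints
-- to a conference graph of order 6 + 4p. The bound for r ≥ 4 applies only
-- to constraints that are known to have an extension.
guaranteed : ℕ → ℕ → ℕ
guaranteed p 0 = 12 ℕ.+ 8 ℕ.* p
guaranteed p 1 = 5 ℕ.+ 4 ℕ.* p
guaranteed p 2 = 2 ℕ.+ 2 ℕ.* p
guaranteed p 3 = p
guaranteed p _ = 1

-- The orthogonality of distinct columns makes the signed adjacency
-- matrix of H a symmetric conference matrix.
module Extensions {p : ℕ} (H : SignedGraph (6 ℕ.+ 4 ℕ.* p))
  (complete : ∀ {i j} → i ≢ j → sign H i j ≢ nothing)
  (orthogonal : ∀ {i j} → i ≢ j → ∑ᶻ (λ l → value (sign H l i) ℤ.* value (sign H l j)) ≡ 0ℤ)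
  where

  open Colours H
  open import Data.Nat.Base using (_+_; _*_; _≤_)

  m : ℕ
  m = 6 + 4 * p

  -- A column of the signed adjacency matrix, negated if `s` is negative. Its entry at `l` is the
  -- one sign `t` for which `(l , t)` agrees with the colour, so common extensions are rows in which
  -- all columns have the same entry.
  column : Colour → Fin m → Maybe Sign
  column (i , s) l = Maybe.map (Sign._* s) (sign H l i)

  hit : Maybe Sign → Sign → ℕ
  hit k t = ⟦ k ≟ˢ just t ⟧

  missing : Maybe Sign → ℕ
  missing nothing  = 1
  missing (just _) = 0

  ~?-hit : ∀ l t c → ⟦ (l , t) ~? c ⟧ ≡ hit (column c l) t
  ~?-hit l t (i , s) = by-cases (sign H l i) t s
    where
    by-cases : ∀ k t s → ⟦ k ≟ˢ just (t Sign.* s) ⟧ ≡ hit (Maybe.map (Sign._* s) k) t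
    by-cases = by-decision (∀-MaybeSign? λ k → ∀-Sign? λ t → ∀-Sign? λ s → _ ℕ.≟ _)

  hitsAt : Sign → List (Maybe Sign) → ℕ
  hitsAt t []      = 1
  hitsAt t (k ∷ K) = hit k t * hitsAt t K

  hits : List (Maybe Sign) → ℕ
  hits K = hitsAt Sign.+ K + hitsAt Sign.- K

  extensions-hits : ∀ L → extensions L ≡ ∑ (λ l → hits (map (λ c → column c l) L))
  extensions-hits L = trans (∑ᶜ≡∑ _)
    (∑-cong (λ l → cong₂ _+_ (extends-hits l Sign.+ L) (extends-hits l Sign.- L)))
    where
    extends-hits : ∀ l t L → extends L (l , t) ≡ hitsAt t (map (λ c → column c l) L)
    extends-hits l t []      = refl
    extends-hits l t (c ∷ L) = cong₂ _*_ (~?-hit l t c) (extends-hits l t L)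

  ∑-missing : ∀ c → ∑ (λ l → missing (column c l)) ≤ 1
  ∑-missing (i , s) = ℕ.≤-trans (∑-mono bound) (ℕ.≤-reflexive (∑-δ i))
    where
    bound : ∀ l → missing (column (i , s) l) ≤ ⟦ l Fin.≟ i ⟧
    bound l with l Fin.≟ i
    ... | yes _  = missing≤1 (column (i , s) l)
      where
      missing≤1 : ∀ k → missing k ≤ 1
      missing≤1 nothing  = s≤s z≤n
      missing≤1 (just _) = z≤n
    ... | no l≢i with sign H l i in eq
    ...   | nothing = ⊥-elim (complete l≢i eq)
    ...   | just _  = z≤n

  extensions₀ : extensions [] ≡ 12 + 8 * p
  extensions₀ = trans (∑ᶜ≡∑ _) (trans (∑-const m 2) (arith p))
    where
    arith : ∀ p → (6 + 4 * p) * 2 ≡ 12 + 8 * p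
    arith = ℕSolver.solve-∀

  -- Each row has one agreeing colour, except for the single row on the diagonal.
  extensions₁ : ∀ c → 5 + 4 * p ≤ extensions (c ∷ [])
  extensions₁ c = ℕ.+-cancelˡ-≤ 1 _ _ (begin
    6 + 4 * p                                                     ≡⟨ trans (∑-const m 1) (ℕ.*-identityʳ m) ⟨
    ∑ {m} (λ _ → 1)                                               ≤⟨ ∑-mono (λ l → pointwise (column c l)) ⟩
    ∑ (λ l → missing (column c l) + hits (column c l ∷ []))       ≡⟨ ∑-+ _ _ ⟩
    ∑ (λ l → missing (column c l)) + ∑ (λ l → hits (column c l ∷ []))
      ≤⟨ ℕ.+-mono-≤ (∑-missing c) (ℕ.≤-reflexive (sym (extensions-hits (c ∷ [])))) ⟩
    1 + extensions (c ∷ [])                                       ∎)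
    where
    open ℕ.≤-Reasoning
    pointwise : ∀ a → 1 ≤ missing a + hits (a ∷ [])
    pointwise = by-decision (∀-MaybeSign? λ a → _ ℕ.≤? _)

  columns-orthogonal : ∀ c d → proj₁ c ≢ proj₁ d → ∑ᶻ (λ l → value (column c l) ℤ.* value (column d l)) ≡ 0ℤ
  columns-orthogonal (i , s) (j , t) i≢j = begin
    ∑ᶻ (λ l → value (column (i , s) l) ℤ.* value (column (j , t) l))
      ≡⟨ ∑ᶻ-cong (λ l → pointwise (sign H l i) (sign H l j) s t) ⟩
    ∑ᶻ (λ l → value (just (s Sign.* t)) ℤ.* (value (sign H l i) ℤ.* value (sign H l j)))
      ≡⟨ *-∑ᶻ (value (just (s Sign.* t))) _ ⟨
    value (just (s Sign.* t)) ℤ.* ∑ᶻ (λ l → value (sign H l i) ℤ.* value (sign H l j))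
      ≡⟨ cong (value (just (s Sign.* t)) ℤ.*_) (orthogonal i≢j) ⟩
    value (just (s Sign.* t)) ℤ.* 0ℤ
      ≡⟨ ℤ.*-zeroʳ (value (just (s Sign.* t))) ⟩
    0ℤ ∎
    where
    open ≡-Reasoning
    pointwise : ∀ a b s t → value (Maybe.map (Sign._* s) a) ℤ.* value (Maybe.map (Sign._* t) b)
                          ≡ value (just (s Sign.* t)) ℤ.* (value a ℤ.* value b)
    pointwise = by-decision (∀-MaybeSign? λ a → ∀-MaybeSign? λ b → ∀-Sign? λ s → ∀-Sign? λ t → _ ℤ.≟ _)

  -- The inner product of the columns is the number of agreeing rows minus the number of disagreeing
  -- ones. As it vanishes, half of the `4 + 4 * p` rows off the two diagonal entries agree.
  extensions₂ : ∀ {c d} → proj₁ c ≢ proj₁ d → 2 + 2 * p ≤ extensions (c ∷ d ∷ [])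
  extensions₂ {c} {d} c≢d = ℕ.*-cancelˡ-≤ 2 (ℕ.+-cancelˡ-≤ 2 _ _ (ℤ.drop‿+≤+ (begin
    + (2 + 2 * (2 + 2 * p))
      ≡⟨ cong +_ (arith p) ⟩
    + m
      ≡⟨ ℤ.+-identityʳ _ ⟨
    + m ℤ.+ 0ℤ
      ≡⟨ cong₂ ℤ._+_ (trans (sym (pos-∑ {m} (λ _ → 1))) (cong +_ (trans (∑-const m 1) (ℕ.*-identityʳ m))))
                     (columns-orthogonal c d c≢d) ⟨
    ∑ᶻ {m} (λ _ → 1ℤ) ℤ.+ ∑ᶻ (λ l → value (a l) ℤ.* value (b l))
      ≡⟨ ∑ᶻ-+ _ _ ⟨
    ∑ᶻ (λ l → 1ℤ ℤ.+ value (a l) ℤ.* value (b l))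
      ≤⟨ ∑ᶻ-mono (λ l → pointwise (a l) (b l)) ⟩
    ∑ᶻ (λ l → + (missing (a l) + missing (b l) + 2 * hits (a l ∷ b l ∷ [])))
      ≡⟨ pos-∑ _ ⟨
    + ∑ (λ l → missing (a l) + missing (b l) + 2 * hits (a l ∷ b l ∷ []))
      ≡⟨ cong +_ (trans (∑-+ _ _) (cong₂ _+_ (∑-+ _ _) (sym (*-∑ 2 _)))) ⟩
    + (∑ (missing ∘ a) + ∑ (missing ∘ b) + 2 * ∑ (λ l → hits (a l ∷ b l ∷ [])))
      ≤⟨ ℤ.+≤+ (ℕ.+-mono-≤ (ℕ.+-mono-≤ (∑-missing c) (∑-missing d))
                 (ℕ.≤-reflexive (cong (2 *_) (sym (extensions-hits (c ∷ d ∷ [])))))) ⟩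
    + (2 + 2 * extensions (c ∷ d ∷ [])) ∎)))
    where
    open ℤ.≤-Reasoning
    a = column c
    b = column d

    arith : ∀ p → 2 + 2 * (2 + 2 * p) ≡ 6 + 4 * p
    arith = ℕSolver.solve-∀

    pointwise : ∀ a b → 1ℤ ℤ.+ value a ℤ.* value b ℤ.≤ + (missing a + missing b + 2 * hits (a ∷ b ∷ []))
    pointwise = by-decision (∀-MaybeSign? λ a → ∀-MaybeSign? λ b → _ ℤ.≤? _)

  -- Of the two colours over l, exactly one agrees with at least two of the
  -- three constraints, unless l is one of the three classes.
  extensions₃ : ∀ {c d e} → proj₁ c ≢ proj₁ d → proj₁ c ≢ proj₁ e → proj₁ d ≢ proj₁ e →
                p ≤ extensions (c ∷ d ∷ e ∷ [])
  extensions₃ {c} {d} {e} c≢d c≢e d≢e = ℕ.*-cancelˡ-≤ 2 (ℕ.+-cancelˡ-≤ m _ _ (begin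
    m + 2 * p
      ≡⟨ arith p ⟩
    2 + 2 * p + (2 + 2 * p) + (2 + 2 * p)
      ≤⟨ ℕ.+-mono-≤ (ℕ.+-mono-≤ (extensions₂ c≢d) (extensions₂ c≢e)) (extensions₂ d≢e) ⟩
    extensions (c ∷ d ∷ []) + extensions (c ∷ e ∷ []) + extensions (d ∷ e ∷ [])
      ≡⟨ cong₂ _+_ (cong₂ _+_ (extensions-hits (c ∷ d ∷ [])) (extensions-hits (c ∷ e ∷ [])))
                   (extensions-hits (d ∷ e ∷ [])) ⟩
    ∑ (λ l → hits (x l ∷ y l ∷ [])) + ∑ (λ l → hits (x l ∷ z l ∷ [])) + ∑ (λ l → hits (y l ∷ z l ∷ []))
      ≡⟨ trans (∑-+ _ _) (cong (_+ ∑ (λ l → hits (y l ∷ z l ∷ []))) (∑-+ _ _)) ⟨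
    ∑ (λ l → hits (x l ∷ y l ∷ []) + hits (x l ∷ z l ∷ []) + hits (y l ∷ z l ∷ []))
      ≤⟨ ∑-mono (λ l → pointwise (x l) (y l) (z l)) ⟩
    ∑ (λ l → 1 + 2 * hits (x l ∷ y l ∷ z l ∷ []))
      ≡⟨ trans (∑-+ _ _) (cong₂ _+_ (trans (∑-const m 1) (ℕ.*-identityʳ m)) (sym (*-∑ 2 _))) ⟩
    m + 2 * ∑ (λ l → hits (x l ∷ y l ∷ z l ∷ []))
      ≡⟨ cong (λ k → m + 2 * k) (extensions-hits (c ∷ d ∷ e ∷ [])) ⟨
    m + 2 * extensions (c ∷ d ∷ e ∷ []) ∎))
    where
    open ℕ.≤-Reasoning
    x = column c
    y = column d
    z = column e

    arith : ∀ p → 6 + 4 * p + 2 * p ≡ 2 + 2 * p + (2 + 2 * p) + (2 + 2 * p)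
    arith = ℕSolver.solve-∀

    -- Three equal signs form three agreeing pairs; in any other row at most one pair agrees.
    pointwise : ∀ x y z → hits (x ∷ y ∷ []) + hits (x ∷ z ∷ []) + hits (y ∷ z ∷ []) ≤ 1 + 2 * hits (x ∷ y ∷ z ∷ [])
    pointwise = by-decision (∀-MaybeSign? λ x → ∀-MaybeSign? λ y → ∀-MaybeSign? λ z → _ ℕ.≤? _)

  guaranteed₂≤₁ : 2 + 2 * p ≤ 5 + 4 * p
  guaranteed₂≤₁ = ℕ.+-mono-≤ {2} {5} (by-decision (2 ℕ.≤? 5)) (ℕ.*-monoˡ-≤ p (by-decision (2 ℕ.≤? 4)))

  guaranteed₃≤₂ : p ≤ 2 + 2 * p
  guaranteed₃≤₂ = ℕ.≤-trans (ℕ.m≤m+n p (1 * p)) (ℕ.m≤n+m (2 * p) 2)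

  extensions-repeat : ∀ c L → extensions (c ∷ L) ≤ extensions (c ∷ c ∷ L)
  extensions-repeat c L = ∑ᶜ-mono (λ x → ℕ.≤-reflexive (sym (⟦⟧-idem (x ~? c) (extends L x))))

  -- Consistent colours over the same vertex of `H` are equal. A repetition costs nothing, and the
  -- shorter list has the larger guarantee.
  consistent₂ : ∀ {c d} → c ≢ antipode d → 2 + 2 * p ≤ extensions (c ∷ d ∷ [])
  consistent₂ c≢ with ≢antipode c≢
  ... | inj₂ i≢j  = extensions₂ i≢j
  ... | inj₁ refl = ℕ.≤-trans guaranteed₂≤₁ (ℕ.≤-trans (extensions₁ _) (extensions-repeat _ []))

  consistent₃ : ∀ {c d e} → c ≢ antipode d → c ≢ antipode e → d ≢ antipode e → p ≤ extensions (c ∷ d ∷ e ∷ [])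
  consistent₃ {c} {d} {e} c≢d c≢e d≢e with ≢antipode c≢d | ≢antipode c≢e | ≢antipode d≢e
  ... | inj₂ i≢j  | inj₂ i≢k  | inj₂ j≢k = extensions₃ i≢j i≢k j≢k
  ... | inj₁ refl | _         | _         =
        ℕ.≤-trans guaranteed₃≤₂ (ℕ.≤-trans (consistent₂ c≢e) (extensions-repeat c (e ∷ [])))
  ... | inj₂ _    | inj₁ refl | _         =
        ℕ.≤-trans guaranteed₃≤₂ (ℕ.≤-trans (consistent₂ c≢d)
          (∑ᶜ-mono (λ x → ℕ.≤-reflexive (rearrange x))))
    where
    rearrange : ∀ x → extends (c ∷ d ∷ []) x ≡ extends (c ∷ d ∷ c ∷ []) x
    rearrange x = trans (sym (⟦⟧-idem (x ~? c) _)) (cong (⟦ x ~? c ⟧ *_) (swap ⟦ x ~? c ⟧ ⟦ x ~? d ⟧))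
      where
      swap : ∀ a b → a * (b * 1) ≡ b * (a * 1)
      swap = ℕSolver.solve-∀
  ... | inj₂ _    | inj₂ _    | inj₁ refl =
        ℕ.≤-trans guaranteed₃≤₂ (ℕ.≤-trans (consistent₂ c≢d)
          (∑ᶜ-mono (λ x → ℕ.≤-reflexive (cong (⟦ x ~? c ⟧ *_) (sym (⟦⟧-idem (x ~? d) 1))))))

  guaranteed≤extensions : ∀ {L} → Consistent L → length L ≤ 3 → guaranteed p (length L) ≤ extensions L
  guaranteed≤extensions {[]}              _ _ = ℕ.≤-reflexive (sym extensions₀)
  guaranteed≤extensions {c ∷ []}          _ _ = extensions₁ c
  guaranteed≤extensions {c ∷ d ∷ []}      ((c≢d ∷ []) ∷ _) _ = consistent₂ c≢d
  guaranteed≤extensions {c ∷ d ∷ e ∷ []}  ((c≢d ∷ c≢e ∷ []) ∷ (d≢e ∷ []) ∷ _) _ = consistent₃ c≢d c≢e d≢e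
  guaranteed≤extensions {_ ∷ _ ∷ _ ∷ _ ∷ _} _ (s≤s (s≤s (s≤s ())))

  -- Meant for the centre of a star, whose old colour satisfies the constraints of all surviving
  -- neighbours, however many there are. Beyond three constraints that colour itself is the one
  -- extension promised.
  satisfiable⇒guaranteed≤extensions : ∀ L {x} → All (x ~_) L → guaranteed p (length L) ≤ extensions L
  satisfiable⇒guaranteed≤extensions L@(_ ∷ _ ∷ _ ∷ _ ∷ _) {x} x~L =
    ℕ.≤-trans (ℕ.≤-reflexive (sym (extends⁺ {L} {x} x~L))) (∑ᶜ-term (extends L) x)
  satisfiable⇒guaranteed≤extensions []               {x} x~L = guaranteed≤extensions (~⇒Consistent {x} x~L) (by-decision (_ ℕ.≤? _))
  satisfiable⇒guaranteed≤extensions (_ ∷ [])         {x} x~L = guaranteed≤extensions (~⇒Consistent {x} x~L) (by-decision (_ ℕ.≤? _))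
  satisfiable⇒guaranteed≤extensions (_ ∷ _ ∷ [])     {x} x~L = guaranteed≤extensions (~⇒Consistent {x} x~L) (by-decision (_ ℕ.≤? _))
  satisfiable⇒guaranteed≤extensions (_ ∷ _ ∷ _ ∷ []) {x} x~L = guaranteed≤extensions (~⇒Consistent {x} x~L) (by-decision (_ ℕ.≤? _))

-- Orthogonality of the columns of SP_q⁺

module _ {q : ℕ} (F : FiniteField q) (q≡1 : q % 4 ≡ 1) where

  open FiniteField F
  open CommutativeRing commutativeRing using (ring; +-comm; -‿inverseʳ)
  open RingProperties ring using (+-inverseʳ-unique; -‿involutive)
  open ≡-Reasoning

  value-SP : ∀ i j → value (sign (SP F q≡1) i j) ≡ χ F q≡1 (element i - element j)
  value-SP i j with i Fin.≟ j | (element i - element j) ≟ 0# | isSquare? (element i - element j)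
  ... | yes _    | yes _    | _     = refl
  ... | yes refl | no  x≢0  | _     = ⊥-elim (x≢0 (-‿inverseʳ (element i)))
  ... | no i≢j   | yes x≡0  | _     = ⊥-elim (i≢j (element-injective
        (trans (+-inverseʳ-unique (- element j) (element i) (trans (+-comm _ _) x≡0)) (-‿involutive _))))
  ... | no _     | no _     | yes _ = refl
  ... | no _     | no _     | no _  = refl

  SP⁺-complete : ∀ {i j} → i ≢ j → sign ((SP F q≡1) ⁺) i j ≢ nothing
  SP⁺-complete {zero}  {zero}  0≢0 = ⊥-elim (0≢0 refl)
  SP⁺-complete {zero}  {suc j} _   = λ ()
  SP⁺-complete {suc i} {zero}  _   = λ ()
  SP⁺-complete {suc i} {suc j} i≢j with i Fin.≟ j | isSquare? (element i - element j)
  ... | yes i≡j | _     = ⊥-elim (i≢j (cong suc i≡j))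
  ... | no _    | yes _ = λ ()
  ... | no _    | no _  = λ ()

  SP⁺-orthogonal₀ : ∀ j →
    ∑ᶻ (λ l → value (sign ((SP F q≡1) ⁺) l zero) ℤ.* value (sign ((SP F q≡1) ⁺) l (suc j))) ≡ 0ℤ
  SP⁺-orthogonal₀ j = trans (∑ᶻ-suc _) (trans (ℤ.+-identityˡ _) (begin
    ∑ᶻ (λ l → 1ℤ ℤ.* value (sign (SP F q≡1) l j))
      ≡⟨ ∑ᶻ-cong (λ l → trans (ℤ.*-identityˡ _) (value-SP l j)) ⟩
    ∑F F q≡1 (λ x → χ F q≡1 (x - element j))
      ≡⟨ trans (∑F-shift F q≡1 (- element j) (χ F q≡1)) (∑χ≡0 F q≡1) ⟩
    0ℤ ∎))

  -- The row of the new vertex adds `1` to the inner product of two old columns and cancels the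
  -- character sum `-1`. Against the column of the new vertex an old column only has to sum to zero.
  SP⁺-orthogonal : ∀ {i j} → i ≢ j →
    ∑ᶻ (λ l → value (sign ((SP F q≡1) ⁺) l i) ℤ.* value (sign ((SP F q≡1) ⁺) l j)) ≡ 0ℤ
  SP⁺-orthogonal {zero}  {zero}  0≢0 = ⊥-elim (0≢0 refl)
  SP⁺-orthogonal {zero}  {suc j} _   = SP⁺-orthogonal₀ j
  SP⁺-orthogonal {suc i} {zero}  _   =
    trans (∑ᶻ-cong (λ l → ℤ.*-comm (value (sign ((SP F q≡1) ⁺) l (suc i))) _)) (SP⁺-orthogonal₀ i)
  SP⁺-orthogonal {suc i} {suc j} i≢j = trans (∑ᶻ-suc _) (cong (λ z → 1ℤ ℤ.+ z) (begin
    ∑ᶻ (λ l → value (sign (SP F q≡1) l i) ℤ.* value (sign (SP F q≡1) l j))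
      ≡⟨ ∑ᶻ-cong (λ l → cong₂ ℤ._*_ (value-SP l i) (value-SP l j)) ⟩
    ∑F F q≡1 (λ x → χ F q≡1 (x - element i) ℤ.* χ F q≡1 (x - element j))
      ≡⟨ ∑χ-χ-≡-1 F q≡1 (λ eq → i≢j (cong suc (element-injective eq))) ⟩
    -1ℤ ∎))

-- Switching, colourings and the chromatic number

just? : ∀ {A : Set} (k : Maybe A) → Dec (∃ λ a → k ≡ just a)
just? nothing  = no λ ()
just? (just a) = yes (a , refl)

edge⇒≢ : ∀ {n} (G : SignedGraph n) {u v s} → sign G u v ≡ just s → u ≢ v
edge⇒≢ G {u} uv refl with () ← trans (sym (loopless G u)) uv

-- A sequence of switches matters only through the parity of the switches at each vertex, which `σ`
-- records.
switched : ∀ {n} → SignedGraph n → (Fin n → Sign) → Fin n → Fin n → Maybe Sign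
switched G σ u v = Maybe.map (λ s → σ u Sign.* (s Sign.* σ v)) (sign G u v)

module _ {n : ℕ} where

  negativeAt : Fin n → Fin n → Sign
  negativeAt x u = if does (u Fin.≟ x) then Sign.- else Sign.+

  switch-switched : ∀ (G : SignedGraph n) x u v → sign (switch x G) u v ≡ switched G (negativeAt x) u v
  switch-switched G x u v with u Fin.≟ x | v Fin.≟ x
  -- A loop would be reversed once by `switch` but twice by `switched`; the two agree because there
  -- is none.
  ... | yes refl | yes refl rewrite loopless G u = refl
  ... | yes _    | no _     = Maybe.map-cong (λ s → cong opposite (sym (Sign.*-identityʳ s))) (sign G u v)
  ... | no _     | yes _    = Maybe.map-cong (λ s → Sign.*-comm Sign.- s) (sign G u v)
  ... | no _     | no _     = trans (sym (Maybe.map-id (sign G u v)))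
                                    (Maybe.map-cong (λ s → sym (Sign.*-identityʳ s)) (sign G u v))

  switched-switched : ∀ (G G′ : SignedGraph n) σ τ → (∀ u v → sign G′ u v ≡ switched G σ u v) →
    ∀ u v → switched G′ τ u v ≡ switched G (λ w → τ w Sign.* σ w) u v
  switched-switched G G′ σ τ G′≡ u v = trans (cong (Maybe.map _) (G′≡ u v))
    (trans (sym (Maybe.map-∘ (sign G u v)))
           (Maybe.map-cong (λ s → rearrange (τ u) (σ u) s (σ v) (τ v)) (sign G u v)))
    where
    rearrange : ∀ a b s c d → a Sign.* (b Sign.* (s Sign.* c) Sign.* d) ≡ a Sign.* b Sign.* (s Sign.* (d Sign.* c))
    rearrange = by-decision (∀-Sign? λ a → ∀-Sign? λ b → ∀-Sign? λ s → ∀-Sign? λ c → ∀-Sign? λ d → _ Sign.≟ _)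

  switchingEquivalent⇒switched : ∀ {G G′ : SignedGraph n} → SwitchingEquivalent G G′ →
    ∃ λ σ → ∀ u v → sign G′ u v ≡ switched G σ u v
  switchingEquivalent⇒switched {G} ε = (λ _ → Sign.+) , λ u v →
    trans (sym (Maybe.map-id (sign G u v))) (Maybe.map-cong (λ s → sym (Sign.*-identityʳ s)) (sign G u v))
  switchingEquivalent⇒switched {G} {G″} (_◅_ {j = G′} (x , G′≡) rest)
    with τ , G″≡ ← switchingEquivalent⇒switched rest =
    (λ w → τ w Sign.* negativeAt x w) , λ u v → trans (G″≡ u v)
      (switched-switched G G′ (negativeAt x) τ (λ u v → trans (G′≡ u v) (switch-switched G x u v)) u v)

  flipAt : Fin n → (Fin n → Sign) → Fin n → Sign
  flipAt x σ u = σ u Sign.* negativeAt x u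

  flipAt-undo : ∀ x σ u → flipAt x σ u Sign.* negativeAt x u ≡ σ u
  flipAt-undo x σ u = trans (Sign.*-assoc (σ u) _ _)
    (trans (cong (σ u Sign.*_) (Sign.s*s≡+ (negativeAt x u))) (Sign.*-identityʳ (σ u)))

  ∈-flipAt : ∀ x {xs} σ → σ x ≡ Sign.- → (∀ u → σ u ≡ Sign.- → u ∈ x ∷ xs) →
             ∀ u → flipAt x σ u ≡ Sign.- → u ∈ xs
  ∈-flipAt x σ σx neg∈ u flip-u with u Fin.≟ x
  ... | yes refl = case trans (sym flip-u) (cong (Sign._* Sign.-) σx) of λ ()
  ... | no u≢x with neg∈ u (trans (sym (Sign.*-identityʳ (σ u))) flip-u)
  ...   | here u≡x = ⊥-elim (u≢x u≡x)
  ...   | there u∈ = u∈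

  -- The list bounds the vertices where `σ` is still negative. Its head is switched only if it is
  -- negative, and `σ` is then corrected there, so that the tail bounds what remains.
  switched⇒switchingEquivalent : ∀ (xs : List (Fin n)) (G : SignedGraph n) σ →
    (∀ u → σ u ≡ Sign.- → u ∈ xs) →
    ∃ λ G′ → SwitchingEquivalent G G′ × (∀ u v → sign G′ u v ≡ switched G σ u v)
  switched⇒switchingEquivalent [] G σ none = G , ε , λ u v →
    trans (sym (Maybe.map-id (sign G u v))) (Maybe.map-cong (λ s → sym (identity u v s)) (sign G u v))
    where
    positive : ∀ u → σ u ≡ Sign.+
    positive u with σ u in eq
    ... | Sign.+ = refl
    ... | Sign.- with () ← none u eq

    identity : ∀ u v s → σ u Sign.* (s Sign.* σ v) ≡ s
    identity u v s = trans (cong₂ (λ a b → a Sign.* (s Sign.* b)) (positive u) (positive v))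
                           (Sign.*-identityʳ s)
  switched⇒switchingEquivalent (x ∷ xs) G σ neg∈ with σ x in σx
  ... | Sign.+ = switched⇒switchingEquivalent xs G σ λ u σu → tail-∈ (neg∈ u σu) λ where
        refl → case trans (sym σu) σx of λ ()
    where
    tail-∈ : ∀ {u} → u ∈ x ∷ xs → u ≢ x → u ∈ xs
    tail-∈ (here u≡x) u≢x = ⊥-elim (u≢x u≡x)
    tail-∈ (there u∈) _   = u∈
  ... | Sign.- with G′ , G⇝G′ , G′≡ ← switched⇒switchingEquivalent xs (switch x G) (flipAt x σ) (∈-flipAt x σ σx neg∈) =
    G′ , (x , λ _ _ → refl) ◅ G⇝G′ , λ u v → trans (G′≡ u v)
      (trans (switched-switched G (switch x G) (negativeAt x) (flipAt x σ) (switch-switched G x) u v)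
             (Maybe.map-cong (λ s → cong₂ (λ a b → a Sign.* (s Sign.* b)) (flipAt-undo x σ u) (flipAt-undo x σ v)) (sign G u v)))

-- Homomorphisms as colourings by the double cover

module _ {n m : ℕ} (G : SignedGraph n) (H : SignedGraph m) where
  open Colours H

  IsColouring : (Fin n → Fin m × Sign) → Set
  IsColouring f = ∀ u v s → sign G u v ≡ just s → f u ~ s ⊙ f v

  -- The signs of the colours tell which vertices to switch, and their first components where to
  -- send them.
  colouring⇒homomorphism : ∀ f → IsColouring f → G ⟶ H
  colouring⇒homomorphism f f-col
    with G′ , G⇝G′ , G′≡ ← switched⇒switchingEquivalent (allFin n) G (proj₂ ∘ f) (λ u _ → ∈-allFin u) =
    proj₁ ∘ f , G′ , G⇝G′ , respects
    where
    respects : ∀ u v s → sign G′ u v ≡ just s → sign H (proj₁ (f u)) (proj₁ (f v)) ≡ just s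
    respects u v s uv with sign G u v in eq | G′≡ u v
    ... | just t  | G′uv = trans (agreement (f-col u v t eq)) (trans (sym G′uv) uv)
    ... | nothing | G′uv with () ← trans (sym uv) G′uv

  homomorphism⇒colouring : G ⟶ H → ∃ IsColouring
  homomorphism⇒colouring (φ , G′ , G⇝G′ , respects) with σ , G′≡ ← switchingEquivalent⇒switched G⇝G′ =
    (λ u → φ u , σ u) , λ u v s uv → agree (respects u v _ (trans (G′≡ u v) (cong (Maybe.map _) uv)))

  isColouring? : ∀ f → Dec (IsColouring f)
  isColouring? f = Fin.all? λ u → Fin.all? λ v → ∀-Sign? λ s →
    (sign G u v ≟ˢ just s) →-dec (f u ~? s ⊙ f v)

  isColouring-resp : ∀ f g → (∀ u → f u ≡ g u) → IsColouring f → IsColouring g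
  isColouring-resp f g f≗g f-col u v s uv = subst₂ (λ c d → c ~ s ⊙ d) (f≗g u) (f≗g v) (f-col u v s uv)

-- Deciding whether a target of given order exists

module _ {n m : ℕ} (G : SignedGraph n) (f : Fin n → Fin m × Sign) where
  open Colours using (agree; agreement)

  -- Lets the search run over `f` alone instead of over targets and maps. If `f` colours `G` in any
  -- target at all, the edges over one pair of vertices share the same switched sign, so it can be
  -- read off whichever of them is found.
  imageSign : Fin m → Fin m → Maybe Sign
  imageSign i j with Fin.any? (λ u → Fin.any? λ v →
      proj₁ (f u) Fin.≟ i ×-dec proj₁ (f v) Fin.≟ j ×-dec just? (sign G u v))
  ... | yes (u , v , _) = switched G (proj₂ ∘ f) u v
  ... | no _            = nothing

  imageSign-correct : ∀ (H : SignedGraph m) → IsColouring G H f → ∀ {u v s} → sign G u v ≡ just s →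
    imageSign (proj₁ (f u)) (proj₁ (f v)) ≡ sign H (proj₁ (f u)) (proj₁ (f v))
  imageSign-correct H f-col {u} {v} {s} uv with Fin.any? (λ u′ → Fin.any? λ v′ →
      proj₁ (f u′) Fin.≟ proj₁ (f u) ×-dec proj₁ (f v′) Fin.≟ proj₁ (f v) ×-dec just? (sign G u′ v′))
  ... | no none = ⊥-elim (none (u , v , refl , refl , s , uv))
  ... | yes (u′ , v′ , u′≡u , v′≡v , t , u′v′) = trans (cong (Maybe.map _) u′v′)
          (trans (sym (agreement (f-col u′ v′ t u′v′))) (cong₂ (sign H) u′≡u v′≡v))

  -- Reading the sign of ij off the pair with the smaller vertex first
  -- makes the image symmetric for every f.
  image : SignedGraph m
  image = record { sign = orderedSign ; symmetric = orderedSign-symmetric ; loopless = orderedSign-loopless }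
    where
    orderedSign : Fin m → Fin m → Maybe Sign
    orderedSign i j with Fin.<-cmp i j
    ... | tri< _ _ _ = imageSign i j
    ... | tri≈ _ _ _ = nothing
    ... | tri> _ _ _ = imageSign j i

    orderedSign-symmetric : ∀ i j → orderedSign i j ≡ orderedSign j i
    orderedSign-symmetric i j with Fin.<-cmp i j | Fin.<-cmp j i
    ... | tri< _ _ _   | tri> _ _ _   = refl
    ... | tri≈ _ _ _   | tri≈ _ _ _   = refl
    ... | tri> _ _ _   | tri< _ _ _   = refl
    ... | tri< i<j _ _ | tri< j<i _ _ = ⊥-elim (ℕ.<-asym i<j j<i)
    ... | tri< _ i≢j _ | tri≈ _ j≡i _ = ⊥-elim (i≢j (sym j≡i))
    ... | tri≈ _ i≡j _ | tri< _ j≢i _ = ⊥-elim (j≢i (sym i≡j))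
    ... | tri≈ _ i≡j _ | tri> _ j≢i _ = ⊥-elim (j≢i (sym i≡j))
    ... | tri> _ i≢j _ | tri≈ _ j≡i _ = ⊥-elim (i≢j (sym j≡i))
    ... | tri> _ _ j<i | tri> _ _ i<j = ⊥-elim (ℕ.<-asym i<j j<i)

    orderedSign-loopless : ∀ i → orderedSign i i ≡ nothing
    orderedSign-loopless i with Fin.<-cmp i i
    ... | tri< _ i≢i _ = ⊥-elim (i≢i refl)
    ... | tri≈ _ _ _   = refl
    ... | tri> _ i≢i _ = ⊥-elim (i≢i refl)

  isColouring-image : ∀ (H : SignedGraph m) → IsColouring G H f → IsColouring G image f
  isColouring-image H f-col u v s uv = agree (ordered (agreement (f-col u v s uv)))
    where
    ordered : ∀ {t} → sign H (proj₁ (f u)) (proj₁ (f v)) ≡ just t →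
              sign image (proj₁ (f u)) (proj₁ (f v)) ≡ just t
    ordered f-uv with Fin.<-cmp (proj₁ (f u)) (proj₁ (f v))
    ... | tri< _ _ _     = trans (imageSign-correct H f-col uv) f-uv
    ... | tri≈ _ fu≡fv _ = ⊥-elim (edge⇒≢ H f-uv fu≡fv)
    ... | tri> _ _ _     = trans (imageSign-correct H f-col (trans (symmetric G v u) uv))
                                 (trans (symmetric H _ _) f-uv)

module _ {m : ℕ} where

  signOf : Fin 2 → Sign
  signOf zero    = Sign.+
  signOf (suc _) = Sign.-

  colourOf : Fin (m ℕ.* 2) → Fin m × Sign
  colourOf c = Product.map₂ signOf (Fin.remQuot 2 c)

  codeOf : Fin m × Sign → Fin (m ℕ.* 2)
  codeOf (i , Sign.+) = Fin.combine i zero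
  codeOf (i , Sign.-) = Fin.combine i (suc zero)

  colourOf-codeOf : ∀ c → colourOf (codeOf c) ≡ c
  colourOf-codeOf (i , Sign.+) = cong (Product.map₂ signOf) (Fin.remQuot-combine i (zero {1}))
  colourOf-codeOf (i , Sign.-) = cong (Product.map₂ signOf) (Fin.remQuot-combine i (suc {1} zero))

module _ {n : ℕ} (G : SignedGraph n) where

  Colourable : ℕ → Set
  Colourable m = Σ (SignedGraph m) (G ⟶_)

  decodeColouring : ∀ {m} → Fin ((m ℕ.* 2) ℕ.^ n) → Fin n → Fin m × Sign
  decodeColouring c = colourOf ∘ Fin.finToFun c

  -- There are finitely many maps to the colours, and each has to be tested only against its own
  -- image. Deciding this for every order is what allows the least one to be found.
  colourable? : ∀ m → Dec (Colourable m)
  colourable? m = map′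
    (λ (c , col) → image G (decodeColouring {m} c) , colouring⇒homomorphism G (image G (decodeColouring {m} c)) (decodeColouring {m} c) col)
    (λ (H , G⟶H) → let (f , f-col) = homomorphism⇒colouring G H G⟶H in
       Fin.funToFin (codeOf ∘ f) ,
       isColouring-image G (decodeColouring {m} (Fin.funToFin (codeOf ∘ f))) H (isColouring-resp G H f _
         (λ u → sym (trans (cong colourOf (Fin.finToFun-funToFin (codeOf ∘ f) u)) (colourOf-codeOf (f u)))) f-col))
    (Fin.any? (λ (c : Fin ((m ℕ.* 2) ℕ.^ n)) → isColouring? G (image G (decodeColouring {m} c)) (decodeColouring {m} c)))

least : ∀ {P : ℕ → Set} → (∀ m → Dec (P m)) → ∀ k → P k → ∃ λ j → P j × j ℕ.≤ k × (∀ {m} → P m → j ℕ.≤ m)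
least {P} P? = <-rec _ step
  where
  step : ∀ k → (∀ {i} → i < k → P i → _) → P k → ∃ λ j → P j × j ℕ.≤ k × (∀ {m} → P m → j ℕ.≤ m)
  step k below pk with ℕ.anyUpTo? P? k
  ... | no none = k , pk , ℕ.≤-refl , λ {m} pm → ℕ.≮⇒≥ (λ m<k → none (m , m<k , pm))
  ... | yes (i , i<k , pi) with j , pj , j≤i , minimal ← below i<k pi =
    j , pj , ℕ.≤-trans j≤i (ℕ.<⇒≤ i<k) , minimal

chromaticNumber≤ : ∀ {n} (G : SignedGraph n) {m} → Colourable G m → ∃ λ j → IsChromaticNumber G j × j ℕ.≤ m
chromaticNumber≤ G colourable with j , colourableⱼ , j≤m , minimal ← least (colourable? G) _ colourable =
  j , (colourableⱼ , λ H G⟶H → minimal (H , G⟶H)) , j≤m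

-- Recolouring a star

present : ∀ {A : Set} → Maybe A → ℕ
present nothing  = 0
present (just _) = 1

module _ {A : Set} where

  collect : ∀ {n} → (Fin n → Maybe A) → List A
  collect {zero}  h = []
  collect {suc n} h = Maybe.maybe′ _∷_ id (h zero) (collect (h ∘ suc))

  length-collect : ∀ {n} (h : Fin n → Maybe A) → length (collect h) ≡ ∑ (present ∘ h)
  length-collect {zero}  h = sym (∑-empty (present ∘ h))
  length-collect {suc n} h = trans step (sym (∑-suc (present ∘ h)))
    where
    step : length (collect h) ≡ present (h zero) ℕ.+ ∑ (present ∘ h ∘ suc)
    step with h zero
    ... | nothing = length-collect (h ∘ suc)
    ... | just _  = cong suc (length-collect (h ∘ suc))

  collect⁺ : ∀ {n} {P : A → Set} (h : Fin n → Maybe A) → (∀ i a → h i ≡ just a → P a) → All P (collect h)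
  collect⁺ {zero}  h ph = []
  collect⁺ {suc n} h ph with h zero in eq
  ... | nothing = collect⁺ (h ∘ suc) (ph ∘ suc)
  ... | just a  = ph zero a eq ∷ collect⁺ (h ∘ suc) (ph ∘ suc)

  collect⁻ : ∀ {n} {P : A → Set} (h : Fin n → Maybe A) → All P (collect h) → ∀ i a → h i ≡ just a → P a
  collect⁻ {suc n} h ps i a eq with h zero in h₀
  collect⁻ {suc n} h ps       (suc i) a eq | nothing = collect⁻ (h ∘ suc) ps i a eq
  collect⁻ {suc n} h (_ ∷ ps) (suc i) a eq | just _  = collect⁻ (h ∘ suc) ps i a eq
  collect⁻ {suc n} h ps       zero    a eq | nothing with () ← trans (sym eq) h₀
  collect⁻ {suc n} h (p ∷ _)  zero    a eq | just _  with refl ← trans (sym eq) h₀ = p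

deg : ∀ {n} → SignedGraph n → Fin n → ℕ
deg G v = ∑ (λ u → present (sign G v u))

module _ {n : ℕ} (G : SignedGraph n) (a : Fin n) (W : Fin n → Bool) where

  private
    removed : Fin n → Fin n → Bool
    removed u v = (does (u Fin.≟ a) ∧ W v) ∨ (does (v Fin.≟ a) ∧ W u)

  deleteStar : SignedGraph n
  deleteStar = record
    { sign      = λ u v → if removed u v then nothing else sign G u v
    ; symmetric = λ u v → cong₂ (λ b s → if b then nothing else s)
                    (∨-comm (does (u Fin.≟ a) ∧ W v) _) (symmetric G u v)
    ; loopless  = λ v → no-loop (removed v v) (loopless G v)
    }
    where
    no-loop : ∀ b {s} → s ≡ nothing → (if b then nothing else s) ≡ nothing
    no-loop true  _  = refl
    no-loop false eq = eq

  deleteStar-≤ : ∀ u v → present (sign deleteStar u v) ℕ.≤ present (sign G u v)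
  deleteStar-≤ u v with removed u v
  ... | true  = z≤n
  ... | false = ℕ.≤-refl

  deleteStar-centre : ∀ v → sign deleteStar a v ≡ (if W v then nothing else sign G a v)
  deleteStar-centre v with a Fin.≟ a | v Fin.≟ a | W v
  ... | no a≢a | _        | _     = ⊥-elim (a≢a refl)
  ... | yes _  | _        | true  = refl
  ... | yes _  | no _     | false = refl
  ... | yes _  | yes refl | false with W a
  ...   | true  = sym (loopless G a)
  ...   | false = refl

  deleteStar-leaf : ∀ {w} → w ≢ a → W w ≡ true →
    ∀ u → sign deleteStar w u ≡ (if does (u Fin.≟ a) then nothing else sign G w u)
  deleteStar-leaf {w} w≢a Ww u with w Fin.≟ a | u Fin.≟ a
  ... | yes w≡a | _     = ⊥-elim (w≢a w≡a)
  ... | no _    | no _  = refl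
  ... | no _    | yes _ rewrite Ww = refl

  deleteStar-other : ∀ {u v} → u ≢ a → v ≢ a → sign deleteStar u v ≡ sign G u v
  deleteStar-other {u} {v} u≢a v≢a with u Fin.≟ a | v Fin.≟ a
  ... | yes u≡a | _       = ⊥-elim (u≢a u≡a)
  ... | no _    | yes v≡a = ⊥-elim (v≢a v≡a)
  ... | no _    | no _    = refl

  module _ (W⊆N : ∀ {w} → W w ≡ true → ∃ λ s → sign G a w ≡ just s) where

    leaf≢centre : ∀ {w} → W w ≡ true → w ≢ a
    leaf≢centre Ww refl with s , aa ← W⊆N Ww = edge⇒≢ G aa refl

    deg-leaf : ∀ {w} → W w ≡ true → deg G w ≡ suc (deg deleteStar w)
    deg-leaf {w} Ww = trans (∑-cong pointwise)
      (trans (∑-+ (λ u → ⟦ u Fin.≟ a ⟧) _) (cong (ℕ._+ deg deleteStar w) (∑-δ a)))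
      where
      pointwise : ∀ u → present (sign G w u) ≡ ⟦ u Fin.≟ a ⟧ ℕ.+ present (sign deleteStar w u)
      pointwise u rewrite deleteStar-leaf (leaf≢centre Ww) Ww u with u Fin.≟ a
      ... | no _     = refl
      ... | yes refl with s , aw ← W⊆N Ww = cong present (trans (symmetric G w a) aw)

module Recolouring {p : ℕ} (H : SignedGraph (6 ℕ.+ 4 ℕ.* p)) (0<p : 0 < p)
  (complete : ∀ {i j} → i ≢ j → sign H i j ≢ nothing)
  (orthogonal : ∀ {i j} → i ≢ j → ∑ᶻ (λ l → value (sign H l i) ℤ.* value (sign H l j)) ≡ 0ℤ)
  where

  open Colours H
  open Extensions {p} H complete orthogonal
  open import Data.Nat.Base using (_+_; _*_; _≤_)

  ∑ᶜ-⊙-δ : ∀ s c → ∑ᶜ (λ x → ⟦ s ⊙ x ≟ᶜ c ⟧) ≡ 1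
  ∑ᶜ-⊙-δ s (i , t) = trans (∑ᶜ≡∑ _) (trans (∑-cong pointwise) (∑-δ i))
    where
    signs : ∀ s t → ⟦ s Sign.* Sign.+ Sign.≟ t ⟧ + ⟦ s Sign.* Sign.- Sign.≟ t ⟧ ≡ 1
    signs = by-decision (∀-Sign? λ s → ∀-Sign? λ t → _ ℕ.≟ _)

    pointwise : ∀ l → ⟦ s ⊙ (l , Sign.+) ≟ᶜ (i , t) ⟧ + ⟦ s ⊙ (l , Sign.-) ≟ᶜ (i , t) ⟧ ≡ ⟦ l Fin.≟ i ⟧
    pointwise l with toSum (l Fin.≟ i)
    ... | inj₂ l≢i  = trans (cong₂ _+_ (⟦⟧-false (_ ≟ᶜ _) (l≢i ∘ cong proj₁)) (⟦⟧-false (_ ≟ᶜ _) (l≢i ∘ cong proj₁)))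
                            (sym (⟦⟧-false (l Fin.≟ i) l≢i))
    ... | inj₁ refl = trans (cong₂ _+_ (same _) (same _)) (trans (signs s t) (sym (⟦⟧-true (l Fin.≟ l) refl)))
      where
      same : ∀ u → ⟦ (l , u) ≟ᶜ (l , t) ⟧ ≡ ⟦ u Sign.≟ t ⟧
      same u = ⟦⟧-cong (_ ≟ᶜ _) (u Sign.≟ t) (cong proj₂) (cong (l ,_))

  -- If the centre gets `x`, an edge of sign `s` imposes `s ⊙ x` on the leaf besides `L`. Each
  -- member of `L` is antipodal to this for exactly one `x`, so a leaf excludes at most `length L`
  -- colours.
  clashes : Maybe Sign → List Colour → Colour → ℕ
  clashes nothing  _       x = 0
  clashes (just s) []      x = 0
  clashes (just s) (c ∷ L) x = ⟦ s ⊙ x ≟ᶜ antipode c ⟧ + clashes (just s) L x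

  ∑ᶜ-if : ∀ b {f : Colour → ℕ} {k} → ∑ᶜ f ≤ k → ∑ᶜ (λ x → if b then f x else 0) ≤ (if b then k else 0)
  ∑ᶜ-if true  f≤k = f≤k
  ∑ᶜ-if false _   = ℕ.≤-reflexive ∑ᶜ-0

  ∑ᶜ-clashes : ∀ k L → ∑ᶜ (clashes k L) ≤ length L
  ∑ᶜ-clashes nothing  L       = ℕ.≤-trans (ℕ.≤-reflexive ∑ᶜ-0) z≤n
  ∑ᶜ-clashes (just s) []      = ℕ.≤-reflexive ∑ᶜ-0
  ∑ᶜ-clashes (just s) (c ∷ L) = ℕ.≤-trans (ℕ.≤-reflexive (∑ᶜ-+ _ _))
    (ℕ.+-mono-≤ (ℕ.≤-reflexive (∑ᶜ-⊙-δ s (antipode c))) (∑ᶜ-clashes (just s) L))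

  no-clashes : ∀ s L x → clashes (just s) L x ≡ 0 → All (λ c → s ⊙ x ≢ antipode c) L
  no-clashes s []      x _  = []
  no-clashes s (c ∷ L) x eq =
    (λ sx≡ → case trans (sym (⟦⟧-true (s ⊙ x ≟ᶜ antipode c) sx≡)) (ℕ.m+n≡0⇒m≡0 _ eq) of λ ()) ∷
    no-clashes s L x (ℕ.m+n≡0⇒n≡0 ⟦ s ⊙ x ≟ᶜ antipode c ⟧ eq)

  guaranteed-positive : ∀ r → 0 < guaranteed p r
  guaranteed-positive 0 = s≤s z≤n
  guaranteed-positive 1 = s≤s z≤n
  guaranteed-positive 2 = s≤s z≤n
  guaranteed-positive 3 = 0<p
  guaranteed-positive (suc (suc (suc (suc _)))) = s≤s z≤n

  -- The reason for leaves of degree at most 3: the constraint from the recoloured centre is one of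
  -- the three.
  consistent⇒satisfiable : ∀ {L} → Consistent L → length L ≤ 3 → ∃ λ x → All (x ~_) L
  consistent⇒satisfiable {L} con len = proj₁ extension , extends⁻ L (proj₂ extension)
    where
    open ℕ.≤-Reasoning
    extension : ∃ λ x → 0 < extends L x
    extension = ∑ᶜ-<⇒∃ (λ _ → 0) (extends L) (begin-strict
      ∑ᶜ (λ _ → 0)             ≡⟨ ∑ᶜ-0 ⟩
      0                        <⟨ guaranteed-positive (length L) ⟩
      guaranteed p (length L)  ≤⟨ guaranteed≤extensions con len ⟩
      extensions L             ∎)

  module _ {n : ℕ} (G G′ : SignedGraph n) (a : Fin n) (W : Fin n → Bool)
    (W⊆N : ∀ {w} → W w ≡ true → ∃ λ s → sign G a w ≡ just s)
    (independent : ∀ {w w′} → W w ≡ true → W w′ ≡ true → sign G w w′ ≡ nothing)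
    (G′-centre : ∀ {v} → W v ≡ false → sign G′ a v ≡ sign G a v)
    (G′-other : ∀ {u v} → u ≢ a → v ≢ a → sign G′ u v ≡ sign G u v)
    where

    module _ {f : Fin n → Colour} (f-col : IsColouring G′ H f) where

      constraint : Fin n → Fin n → Maybe Colour
      constraint v u = Maybe.map (_⊙ f u) (sign G′ v u)

      K : Fin n → List Colour
      K v = collect (constraint v)

      length-K : ∀ v → length (K v) ≡ deg G′ v
      length-K v = trans (length-collect (constraint v)) (∑-cong (λ u → present-map (sign G′ v u)))
        where
        present-map : ∀ {g : Sign → Colour} k → present (Maybe.map g k) ≡ present k
        present-map nothing  = refl
        present-map (just _) = refl

      K⁻ : ∀ {x v} → All (x ~_) (K v) → ∀ u s → sign G′ v u ≡ just s → x ~ s ⊙ f u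
      K⁻ {x} {v} x~K u s vu = collect⁻ {P = x ~_} (constraint v) x~K u _ (cong (Maybe.map _) vu)

      f~K : ∀ v → All (f v ~_) (K v)
      f~K v = collect⁺ (constraint v) satisfied
        where
        satisfied : ∀ u c → constraint v u ≡ just c → f v ~ c
        satisfied u c eq with sign G′ v u in vu
        satisfied u c refl | just s = f-col v u s vu

      clash : Fin n → Colour → ℕ
      clash w x = if W w then clashes (sign G a w) (K w) x else 0

      ∑ᶜ-clash : ∀ w → ∑ᶜ (clash w) ≤ (if W w then deg G′ w else 0)
      ∑ᶜ-clash w = ∑ᶜ-if (W w) (ℕ.≤-trans (∑ᶜ-clashes (sign G a w) (K w)) (ℕ.≤-reflexive (length-K w)))

      -- Both quantities are compared in total over all colours. Since `extends` is at most 1, the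
      -- strict inequality says two things at once: `x` satisfies the surviving constraints on `a`,
      -- and it clashes with no leaf.
      centre : ∑ (λ w → if W w then deg G′ w else 0) < guaranteed p (deg G′ a) →
               ∃ λ x → ∑ (λ w → clash w x) < extends (K a) x
      centre few = ∑ᶜ-<⇒∃ _ _ (begin-strict
        ∑ᶜ (λ x → ∑ (λ w → clash w x))              ≡⟨ ∑ᶜ-∑-swap clash ⟩
        ∑ (λ w → ∑ᶜ (clash w))                      ≤⟨ ∑-mono ∑ᶜ-clash ⟩
        ∑ (λ w → if W w then deg G′ w else 0)       <⟨ few ⟩
        guaranteed p (deg G′ a)                     ≡⟨ cong (guaranteed p) (length-K a) ⟨
        guaranteed p (length (K a))                 ≤⟨ satisfiable⇒guaranteed≤extensions (K a) (f~K a) ⟩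
        extensions (K a)                            ∎)
        where open ℕ.≤-Reasoning

      module _ (x : Colour) where

        Leaf : Fin n → Colour → Set
        Leaf w c = (∀ s → sign G a w ≡ just s → c ~ s ⊙ x) × All (c ~_) (K w)

        clash-leaf : ∀ {w s} → W w ≡ true → sign G a w ≡ just s → clash w x ≡ clashes (just s) (K w) x
        clash-leaf {w} Ww aw = cong₂ (λ b k → if b then clashes k (K w) x else 0) Ww aw

        leaf : (∀ {w} → W w ≡ true → deg G′ w ≤ 2) → (∀ w → clash w x ≡ 0) → ∀ w → W w ≡ true → ∃ (Leaf w)
        leaf small clash≡0 w Ww with s , aw ← W⊆N Ww
          with c , c~sx ∷ c~K ← consistent⇒satisfiable {s ⊙ x ∷ K w}
            -- The old colour of `w` satisfies all of `K w`, which is therefore consistent in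
            -- itself; only the constraint from the centre has to be compared with it.
            (no-clashes s (K w) x (trans (sym (clash-leaf Ww aw)) (clash≡0 w)) ∷ ~⇒Consistent (f~K w))
            (s≤s (ℕ.≤-trans (ℕ.≤-reflexive (length-K w)) (small Ww))) =
          c , (λ { t at → subst (λ t → c ~ t ⊙ x) (Maybe.just-injective (trans (sym aw) at)) c~sx }) , c~K

        other : Fin n → Colour
        other u = if does (u Fin.≟ a) then x else f u

        chosen : (∀ w → W w ≡ true → ∃ (Leaf w)) → ∀ u → ∃ λ c → (W u ≡ true → Leaf u c) × (W u ≡ false → c ≡ other u)
        chosen leaves u with W u in Wu
        ... | true  = let c , c-leaf = leaves u Wu in c , (λ _ → c-leaf) , λ ()
        ... | false = other u , (λ ()) , λ _ → refl

        module _ (x~K : All (x ~_) (K a)) (g : Fin n → Colour)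
          (g-leaf : ∀ {u} → W u ≡ true → Leaf u (g u))
          (g-rest : ∀ {u} → W u ≡ false → g u ≡ other u)
          where

          g-centre : W a ≡ false → g a ≡ x
          g-centre Wa rewrite g-rest Wa with a Fin.≟ a
          ... | yes _  = refl
          ... | no a≢a = ⊥-elim (a≢a refl)

          g-other : ∀ {u} → W u ≡ false → u ≢ a → g u ≡ f u
          g-other {u} Wu u≢a rewrite g-rest Wu with u Fin.≟ a
          ... | yes u≡a = ⊥-elim (u≢a u≡a)
          ... | no _    = refl

          from-leaf : ∀ {u v s} → W u ≡ true → W v ≡ false → sign G u v ≡ just s → g u ~ s ⊙ g v
          from-leaf {u} {v} {s} Wu Wv uv with v Fin.≟ a
          ... | yes refl = subst (λ c → g u ~ s ⊙ c) (sym (g-centre Wv))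
                             (proj₁ (g-leaf Wu) s (trans (symmetric G a u) uv))
          ... | no v≢a   = subst (λ c → g u ~ s ⊙ c) (sym (g-other Wv v≢a))
                             (K⁻ {g u} {u} (proj₂ (g-leaf Wu)) v s
                               (trans (G′-other (leaf≢centre G a W W⊆N Wu) v≢a) uv))

          from-centre : ∀ {v s} → W a ≡ false → W v ≡ false → sign G a v ≡ just s → g a ~ s ⊙ g v
          from-centre {v} {s} Wa Wv av =
            subst₂ (λ c d → c ~ s ⊙ d) (sym (g-centre Wa)) (sym (g-other Wv (edge⇒≢ G av ∘ sym)))
              (K⁻ {x} {a} x~K v s (trans (G′-centre Wv) av))

          g-col : IsColouring G H g
          g-col u v s uv with W u in Wu | W v in Wv
          ... | true  | true with () ← trans (sym uv) (independent Wu Wv)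
          ... | true  | false = from-leaf Wu Wv uv
          ... | false | true  = ⊙-~ s {g v} {g u} (from-leaf Wv Wu (trans (symmetric G v u) uv))
          ... | false | false with u Fin.≟ a | v Fin.≟ a
          ...   | yes refl | _        = from-centre Wu Wv uv
          ...   | no _     | yes refl = ⊙-~ s {g a} {g u} (from-centre Wv Wu (trans (symmetric G a u) uv))
          ...   | no u≢a   | no v≢a   = subst₂ (λ c d → c ~ s ⊙ d) (sym (g-other Wu u≢a)) (sym (g-other Wv v≢a))
                                          (f-col u v s (trans (G′-other u≢a v≢a) uv))

    recolour : (∀ {w} → W w ≡ true → deg G′ w ≤ 2) →
               ∑ (λ w → if W w then deg G′ w else 0) < guaranteed p (deg G′ a) →
               ∃ (IsColouring G′ H) → ∃ (IsColouring G H)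
    recolour small few (f , f-col) with x , few-clashes ← centre f-col few =
      _ , g-col f-col x (extends⁻ (K f-col a) (ℕ.≤-<-trans z≤n few-clashes)) (proj₁ ∘ choice)
            (λ {u} → proj₁ (proj₂ (choice u))) (λ {u} → proj₂ (proj₂ (choice u)))
      where
      clash≡0 : ∀ w → clash f-col w x ≡ 0
      clash≡0 w = ℕ.n≤0⇒n≡0 (ℕ.≤-trans (∑-term (λ w → clash f-col w x) w)
        (ℕ.≤-pred (ℕ.≤-trans few-clashes (extends≤1 (K f-col a) x))))

      choice : ∀ u → ∃ λ c → (W u ≡ true → Leaf f-col x u c) × (W u ≡ false → c ≡ other f-col x u)
      choice = chosen f-col x (leaf f-col x small clash≡0)

-- Discharging

module Discharging (p : ℕ) {n : ℕ} (G : SignedGraph n) where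
  open import Data.Nat.Base using (_+_; _*_; _≤_; _∸_)

  cost : (Fin n → Bool) → ℕ
  cost W = ∑ (λ w → if W w then deg G w ∸ 1 else 0)

  restDegree : Fin n → (Fin n → Bool) → ℕ
  restDegree a W = ∑ (λ u → if W u then 0 else present (sign G a u))

  record Reducible (a : Fin n) (W : Fin n → Bool) : Set where
    field
      neighbours  : ∀ {w} → W w ≡ true → ∃ λ s → sign G a w ≡ just s
      nonempty    : ∃ λ w → W w ≡ true
      independent : ∀ {w w′} → W w ≡ true → W w′ ≡ true → sign G w w′ ≡ nothing
      weak        : ∀ {w} → W w ≡ true → deg G w ≤ 3
      few         : cost W < guaranteed p (restDegree a W)

  -- With q = 5 + 4p, all charges of the rational discharging are multiplied
  -- by unit = 3(q + 3)/4, which turns 4 - 8/(q + 3) into target.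
  unit target : ℕ
  unit   = 6 + 3 * p
  target = 18 + 12 * p

  -- A vertex of degree 2 or 3 receives this from each of its neighbours and so reaches `target`
  -- exactly: `2 * unit + 2 * (3 + 3 * p)` and `3 * unit + 3 * p` both equal it.
  transfer : ℕ → ℕ
  transfer 2 = 3 + 3 * p
  transfer 3 = p
  transfer _ = 0

  -- Deleting a star keeps all vertices and may isolate some. Isolated vertices have no charge and
  -- no neighbour to pay them, so they are left out of the average.
  nonisolated : Fin n → ℕ
  nonisolated v = ⟦ 0 ℕ.<? deg G v ⟧

  weakNeighbour : Fin n → Fin n → Bool
  weakNeighbour a u = is-just (sign G a u) ∧ (deg G u ℕ.≤ᵇ 3)

  -- The star with the single leaf `w` is then reducible: `deg G w ∸ 1` colours are excluded and
  -- `deg G a ∸ 1` constraints remain on `a`. The centre may itself have degree at most 3.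
  LightEdge : Fin n → Fin n → Set
  LightEdge a w = (∃ λ s → sign G a w ≡ just s) × deg G w ≤ 3 × deg G w ≤ guaranteed p (deg G a ∸ 1)

  lightEdge? : ∀ a w → Dec (LightEdge a w)
  lightEdge? a w = just? (sign G a w) ×-dec (deg G w ℕ.≤? 3) ×-dec (deg G w ℕ.≤? guaranteed p (deg G a ∸ 1))

  present≤deg : ∀ v u → present (sign G v u) ≤ deg G v
  present≤deg v u = ∑-term (λ u → present (sign G v u)) u

  edge⇒deg>0 : ∀ {v u s} → sign G v u ≡ just s → 0 < deg G v
  edge⇒deg>0 {v} {u} vu = ℕ.≤-trans (ℕ.≤-reflexive (cong present (sym vu))) (present≤deg v u)

  deg>0⇒edge : ∀ v → 0 < deg G v → ∃ λ u → ∃ λ s → sign G v u ≡ just s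
  deg>0⇒edge v 0<d with u , 0<vu ← ∑-<⇒∃ (λ _ → 0) (λ u → present (sign G v u))
                                     (subst (_< deg G v) (sym (∑-zero n)) 0<d) = u , edge 0<vu
    where
    edge : ∀ {k : Maybe Sign} → 0 < present k → ∃ λ s → k ≡ just s
    edge {just s} _ = s , refl

  lightEdge⇒reducible : ∀ {a w} → LightEdge a w → Reducible a (λ u → does (u Fin.≟ w))
  lightEdge⇒reducible {a} {w} ((s , aw) , deg≤3 , deg≤guaranteed) = record
    { neighbours  = λ {u} u≡w → s , trans (cong (sign G a) (is u u≡w)) aw
    ; nonempty    = w , dec-true (w Fin.≟ w) refl
    ; independent = λ {u} {u′} u≡w u′≡w → trans (cong₂ (sign G) (is u u≡w) (is u′ u′≡w)) (loopless G w)
    ; weak        = λ {u} u≡w → subst (λ u → deg G u ≤ 3) (sym (is u u≡w)) deg≤3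
    ; few         = begin-strict
        cost (λ u → does (u Fin.≟ w))     ≡⟨ ∑-cong (λ u → if≡⟦⟧* (u Fin.≟ w) (deg G u ∸ 1)) ⟩
        ∑ (λ u → ⟦ u Fin.≟ w ⟧ * (deg G u ∸ 1))  ≡⟨ ∑-single w (λ u → deg G u ∸ 1) ⟩
        deg G w ∸ 1                       <⟨ ℕ.≤-trans (ℕ.≤-reflexive (ℕ.m+[n∸m]≡n deg>0)) deg≤guaranteed ⟩
        guaranteed p (deg G a ∸ 1)        ≡⟨ cong (λ d → guaranteed p (d ∸ 1)) deg-a ⟩
        guaranteed p (restDegree a (λ u → does (u Fin.≟ w))) ∎
    }
    where
    open ℕ.≤-Reasoning
    is : ∀ u → does (u Fin.≟ w) ≡ true → u ≡ w
    is u eq with u Fin.≟ w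
    ... | yes u≡w = u≡w
    ... | no _ with () ← eq

    if≡⟦⟧* : ∀ {P : Set} (d : Dec P) k → (if does d then k else 0) ≡ ⟦ d ⟧ * k
    if≡⟦⟧* (yes _) k = sym (ℕ.+-identityʳ k)
    if≡⟦⟧* (no _)  k = refl

    deg>0 : 0 < deg G w
    deg>0 = edge⇒deg>0 (trans (symmetric G w a) aw)

    deg-a : deg G a ≡ suc (restDegree a (λ u → does (u Fin.≟ w)))
    deg-a = trans (∑-cong pointwise) (trans (∑-+ (λ u → ⟦ u Fin.≟ w ⟧) _) (cong (_+ restDegree a (λ u → does (u Fin.≟ w))) (∑-δ w)))
      where
      pointwise : ∀ u → present (sign G a u)
                      ≡ ⟦ u Fin.≟ w ⟧ + (if does (u Fin.≟ w) then 0 else present (sign G a u))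
      pointwise u with u Fin.≟ w
      ... | no _     = refl
      ... | yes refl = cong present aw

  weakNeighbour⁻ : ∀ {a u} → weakNeighbour a u ≡ true → (∃ λ s → sign G a u ≡ just s) × deg G u ≤ 3
  weakNeighbour⁻ {a} {u} eq with sign G a u
  ... | just s = (s , refl) , ℕ.≤ᵇ⇒≤ (deg G u) 3 (subst T (sym eq) _)

  module _ (2≤p : 2 ≤ p) where

    private
      3≤guaranteed : ∀ {d} → d ≤ 3 → 3 ≤ guaranteed p (d ∸ 1)
      3≤guaranteed {0} _ = ℕ.m≤m+n 3 _
      3≤guaranteed {1} _ = ℕ.m≤m+n 3 _
      3≤guaranteed {2} _ = ℕ.m≤m+n 3 _
      3≤guaranteed {3} _ = ℕ.+-monoʳ-≤ 2 (ℕ.≤-trans (s≤s z≤n) (ℕ.≤-trans 2≤p (ℕ.m≤m+n p _)))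
      3≤guaranteed {suc (suc (suc (suc _)))} (s≤s (s≤s (s≤s ())))

    module _ (noLightEdge : ¬ ∃₂ LightEdge) where

      -- Between two vertices of degree at most 3 the edge is light, because at most two other
      -- constraints on the centre leave it at least three colours. Hence weak neighbours are never
      -- adjacent, and weak vertices pay nothing.
      weak-independent : ∀ {u v s} → sign G u v ≡ just s → deg G u ≤ 3 → 3 < deg G v
      weak-independent uv u≤3 = ℕ.≰⇒> (λ v≤3 →
        noLightEdge (_ , _ , (_ , uv) , v≤3 , ℕ.≤-trans v≤3 (3≤guaranteed u≤3)))

      weakNeighbours-reducible : ∀ a → ∃ (λ w → weakNeighbour a w ≡ true) →
        cost (weakNeighbour a) < guaranteed p (restDegree a (weakNeighbour a)) → Reducible a (weakNeighbour a)
      weakNeighbours-reducible a nonempty few = record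
        { neighbours  = proj₁ ∘ weakNeighbour⁻
        ; nonempty    = nonempty
        ; independent = independent
        ; weak        = proj₂ ∘ weakNeighbour⁻ {a}
        ; few         = few
        }
        where
        independent : ∀ {w w′} → weakNeighbour a w ≡ true → weakNeighbour a w′ ≡ true → sign G w w′ ≡ nothing
        independent {w} {w′} w∈ w′∈ with sign G w w′ in eq
        ... | nothing = refl
        ... | just _  = ⊥-elim (ℕ.<⇒≱ (weak-independent eq (proj₂ (weakNeighbour⁻ {a} w∈))) (proj₂ (weakNeighbour⁻ {a} w′∈)))

      transferred : Fin n → ℕ
      transferred v = ∑ (λ u → present (sign G v u) * transfer (deg G u))

      transfer-strong : ∀ {d} → 3 < d → transfer d ≡ 0
      transfer-strong (s≤s (s≤s (s≤s (s≤s _)))) = refl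

      weak⇒transferred≡0 : ∀ v → deg G v ≤ 3 → transferred v ≡ 0
      weak⇒transferred≡0 v v≤3 = trans (∑-cong (λ u → pointwise u (sign G v u) refl)) (∑-zero n)
        where
        pointwise : ∀ u k → sign G v u ≡ k → present k * transfer (deg G u) ≡ 0
        pointwise u nothing  _  = refl
        pointwise u (just _) vu = cong (λ t → t + 0) (transfer-strong (weak-independent vu v≤3))

      -- A vertex of degree 1 excludes no colour of its neighbour, so the edge to it is light.
      leaf-free : ∀ v → deg G v ≢ 1
      leaf-free v deg≡1 with a , s , va ← deg>0⇒edge v (ℕ.≤-reflexive (sym deg≡1)) =
        noLightEdge (a , v , (s , trans (symmetric G a v) va) ,
          subst (_≤ 3) (sym deg≡1) (s≤s z≤n) , subst (_≤ guaranteed p (deg G a ∸ 1)) (sym deg≡1) (positive (deg G a ∸ 1)))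
        where
        positive : ∀ r → 1 ≤ guaranteed p r
        positive 0 = s≤s z≤n
        positive 1 = s≤s z≤n
        positive 2 = s≤s z≤n
        positive 3 = ℕ.≤-trans (s≤s z≤n) 2≤p
        positive (suc (suc (suc (suc _)))) = s≤s z≤n

      module _ (noWeakStar : ∀ a → ∃ (λ w → weakNeighbour a w ≡ true) →
                 guaranteed p (restDegree a (weakNeighbour a)) ≤ cost (weakNeighbour a)) where

        open ℕ.≤-Reasoning

        -- For a weak neighbour of degree d, the unit carried by its edge
        -- covers both transfer d and 3 for each of the d - 1 excluded colours.
        outflow : ∀ v → unit * restDegree v (weakNeighbour v) + 3 * cost (weakNeighbour v) + transferred v
                      ≤ unit * deg G v
        outflow v = begin
          unit * restDegree v W + 3 * cost W + transferred v
            ≡⟨ cong₂ (λ a b → a + b + transferred v) (*-∑ unit _) (*-∑ 3 _) ⟩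
          ∑ (λ u → unit * rest u) + ∑ (λ u → 3 * excluded u) + transferred v
            ≡⟨ trans (∑-+ _ _) (cong (_+ transferred v) (∑-+ _ _)) ⟨
          ∑ (λ u → unit * rest u + 3 * excluded u + present (sign G v u) * transfer (deg G u))
            ≤⟨ ∑-mono (λ u → pointwise (sign G v u) (deg G u)) ⟩
          ∑ (λ u → unit * present (sign G v u))
            ≡⟨ *-∑ unit _ ⟨
          unit * deg G v ∎
          where
          W = weakNeighbour v

          rest excluded : Fin n → ℕ
          rest u     = if W u then 0 else present (sign G v u)
          excluded u = if W u then deg G u ∸ 1 else 0

          pointwise : ∀ (k : Maybe Sign) d →
            let weak = is-just k ∧ (d ℕ.≤ᵇ 3) in
            unit * (if weak then 0 else present k) + 3 * (if weak then d ∸ 1 else 0) + present k * transfer d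
              ≤ unit * present k
          pointwise nothing  d = ℕ.≤-reflexive (trans (ℕ.+-identityʳ _) (ℕ.+-identityʳ _))
          pointwise (just _) 0 = ℕ.≤-trans (ℕ.≤-reflexive (trans (ℕ.+-identityʳ _) (trans (ℕ.+-identityʳ _) (ℕ.*-zeroʳ unit)))) z≤n
          pointwise (just _) 1 = ℕ.≤-trans (ℕ.≤-reflexive (trans (ℕ.+-identityʳ _) (trans (ℕ.+-identityʳ _) (ℕ.*-zeroʳ unit)))) z≤n
          pointwise (just _) 2 = ℕ.≤-reflexive (arith p)
            where
            arith : ∀ p → (6 + 3 * p) * 0 + 3 + 1 * (3 + 3 * p) ≡ (6 + 3 * p) * 1
            arith = ℕSolver.solve-∀
          pointwise (just _) 3 = ℕ.≤-trans (ℕ.m≤m+n _ (2 * p)) (ℕ.≤-reflexive (arith p))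
            where
            arith : ∀ p → (6 + 3 * p) * 0 + 6 + 1 * p + 2 * p ≡ (6 + 3 * p) * 1
            arith = ℕSolver.solve-∀
          pointwise (just _) (suc (suc (suc (suc d)))) =
            ℕ.≤-reflexive (trans (ℕ.+-identityʳ _) (ℕ.+-identityʳ _))

        -- The charge kept is `unit` for each other edge and 3 for each colour excluded by weak
        -- neighbours. Equality occurs for `r = 2` and `r = 3`.
        target≤ : ∀ r {c} → guaranteed p r ≤ c → target ≤ unit * r + 3 * c
        target≤ r g≤c = ℕ.≤-trans (bound r) (ℕ.+-monoʳ-≤ (unit * r) (ℕ.*-monoʳ-≤ 3 g≤c))
          where
          slack : ∀ {a b} k → a + k ≡ b → a ≤ b
          slack {a} k eq = subst (a ≤_) eq (ℕ.m≤m+n a k)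

          bound : ∀ r → target ≤ unit * r + 3 * guaranteed p r
          bound 0 = slack (18 + 12 * p) (arith p)
            where
            arith : ∀ p → 18 + 12 * p + (18 + 12 * p) ≡ (6 + 3 * p) * 0 + 3 * (12 + 8 * p)
            arith = ℕSolver.solve-∀
          bound 1 = slack (3 + 3 * p) (arith p)
            where
            arith : ∀ p → 18 + 12 * p + (3 + 3 * p) ≡ (6 + 3 * p) * 1 + 3 * (5 + 4 * p)
            arith = ℕSolver.solve-∀
          bound 2 = slack 0 (arith p)
            where
            arith : ∀ p → 18 + 12 * p + 0 ≡ (6 + 3 * p) * 2 + 3 * (2 + 2 * p)
            arith = ℕSolver.solve-∀
          bound 3 = slack 0 (arith p)
            where
            arith : ∀ p → 18 + 12 * p + 0 ≡ (6 + 3 * p) * 3 + 3 * p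
            arith = ℕSolver.solve-∀
          bound (suc (suc (suc (suc r)))) = slack (9 + unit * r) (arith p r)
            where
            arith : ∀ p r → 18 + 12 * p + (9 + (6 + 3 * p) * r) ≡ (6 + 3 * p) * (4 + r) + 3
            arith = ℕSolver.solve-∀

        4-target≤ : ∀ {r} → 4 ≤ r → target ≤ unit * r
        4-target≤ {r} 4≤r = ℕ.≤-trans (ℕ.≤-trans (ℕ.m≤m+n target 6) (ℕ.≤-reflexive (arith p)))
                                      (ℕ.*-monoʳ-≤ unit 4≤r)
          where
          arith : ∀ p → 18 + 12 * p + 6 ≡ (6 + 3 * p) * 4
          arith = ℕSolver.solve-∀

        -- Four edges to strong neighbours suffice by themselves. With fewer there is a weak
        -- neighbour, and irreducibility of the star of all weak neighbours bounds its cost from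
        -- below.
        strong-charged : ∀ v → 4 ≤ deg G v →
          target ≤ unit * restDegree v (weakNeighbour v) + 3 * cost (weakNeighbour v)
        strong-charged v 4≤d with 4 ℕ.≤? restDegree v (weakNeighbour v)
        ... | yes 4≤r = ℕ.≤-trans (4-target≤ 4≤r) (ℕ.m≤m+n _ _)
        ... | no  4≰r with u , r<d ← ∑-<⇒∃ _ _ (ℕ.<-≤-trans (ℕ.≰⇒> 4≰r) 4≤d) =
          target≤ (restDegree v (weakNeighbour v)) (noWeakStar v (u , weak (weakNeighbour v u) r<d))
          where
          weak : ∀ b {k} → (if b then 0 else k) < k → b ≡ true
          weak true  _   = refl
          weak false k<k = ⊥-elim (ℕ.<-irrefl refl k<k)

        vertex-charged : ∀ v → target * nonisolated v + transferred v ≤ unit * deg G v + deg G v * transfer (deg G v)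
        vertex-charged v = by-degree (deg G v) refl
          where
          by-degree : ∀ d → deg G v ≡ d → target * ⟦ 0 ℕ.<? d ⟧ + transferred v ≤ unit * d + d * transfer d
          by-degree 0 d≡ = ℕ.≤-reflexive (cong₂ _+_ (trans (ℕ.*-zeroʳ target) (sym (ℕ.*-zeroʳ unit)))
                             (weak⇒transferred≡0 v (subst (_≤ 3) (sym d≡) z≤n)))
          by-degree 1 d≡ = ⊥-elim (leaf-free v d≡)
          by-degree 2 d≡ = ℕ.≤-reflexive (trans
            (cong (λ t → target * 1 + t) (weak⇒transferred≡0 v (subst (_≤ 3) (sym d≡) (s≤s (s≤s z≤n))))) (arith p))
            where
            arith : ∀ p → (18 + 12 * p) * 1 + 0 ≡ (6 + 3 * p) * 2 + 2 * (3 + 3 * p)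
            arith = ℕSolver.solve-∀
          by-degree 3 d≡ = ℕ.≤-reflexive (trans
            (cong (λ t → target * 1 + t) (weak⇒transferred≡0 v (subst (_≤ 3) (sym d≡) (s≤s (s≤s (s≤s z≤n)))))) (arith p))
            where
            arith : ∀ p → (18 + 12 * p) * 1 + 0 ≡ (6 + 3 * p) * 3 + 3 * p
            arith = ℕSolver.solve-∀
          by-degree d@(suc (suc (suc (suc _)))) d≡ = begin
            target * 1 + transferred v
              ≡⟨ cong (_+ transferred v) (ℕ.*-identityʳ target) ⟩
            target + transferred v
              ≤⟨ ℕ.+-monoˡ-≤ (transferred v)
                   (strong-charged v (subst (4 ≤_) (sym d≡) (s≤s (s≤s (s≤s (s≤s z≤n)))))) ⟩
            unit * restDegree v (weakNeighbour v) + 3 * cost (weakNeighbour v) + transferred v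
              ≤⟨ outflow v ⟩
            unit * deg G v
              ≡⟨ cong (unit *_) d≡ ⟩
            unit * d
              ≤⟨ ℕ.m≤m+n _ _ ⟩
            unit * d + d * 0 ∎

        -- What is paid and what is received are one double sum read in two orders, so the transfers
        -- cancel.
        total-charged : target * ∑ nonisolated ≤ unit * ∑ (deg G)
        total-charged = ℕ.+-cancelʳ-≤ (∑ (λ v → deg G v * transfer (deg G v))) _ _ (begin
          target * ∑ nonisolated + ∑ (λ u → deg G u * transfer (deg G u))
            ≡⟨ cong₂ _+_ (*-∑ target nonisolated) (∑-cong received) ⟩
          ∑ (λ v → target * nonisolated v) + ∑ (λ u → ∑ (λ v → present (sign G v u) * transfer (deg G u)))
            ≡⟨ cong (λ t → ∑ (λ v → target * nonisolated v) + t) (∑-swap _) ⟨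
          ∑ (λ v → target * nonisolated v) + ∑ transferred
            ≡⟨ ∑-+ _ _ ⟨
          ∑ (λ v → target * nonisolated v + transferred v)
            ≤⟨ ∑-mono vertex-charged ⟩
          ∑ (λ v → unit * deg G v + deg G v * transfer (deg G v))
            ≡⟨ trans (∑-+ _ _) (cong (_+ ∑ (λ v → deg G v * transfer (deg G v))) (sym (*-∑ unit (deg G)))) ⟩
          unit * ∑ (deg G) + ∑ (λ v → deg G v * transfer (deg G v)) ∎)
          where
          received : ∀ u → deg G u * transfer (deg G u) ≡ ∑ (λ v → present (sign G v u) * transfer (deg G u))
          received u = trans (∑-* (transfer (deg G u)) _)
            (∑-cong (λ v → cong (λ k → present k * transfer (deg G u)) (symmetric G u v)))

    reducible-or-charged : ∃₂ Reducible ⊎ target * ∑ nonisolated ≤ unit * ∑ (deg G)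
    reducible-or-charged with Fin.any? (λ a → Fin.any? (lightEdge? a))
    ... | yes (a , w , light) = inj₁ (a , _ , lightEdge⇒reducible light)
    ... | no noLightEdge with Fin.any? (λ a →
            Fin.any? (λ w → weakNeighbour a w Bool.≟ true) ×-dec
            (cost (weakNeighbour a) ℕ.<? guaranteed p (restDegree a (weakNeighbour a))))
    ...   | yes (a , nonempty , few) = inj₁ (a , _ , weakNeighbours-reducible noLightEdge a nonempty few)
    ...   | no noWeakStar = inj₂ (total-charged noLightEdge
              (λ a nonempty → ℕ.≮⇒≥ (λ few → noWeakStar (a , nonempty , few))))

-- Induction on the number of edges

-- The bound on `mad` for induced subgraphs with denominators cleared. The double sum runs over
-- ordered pairs and so is twice the number of edges inside `P`.
Sparse : ℕ → ∀ {n} → SignedGraph n → Set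
Sparse p {n} G = ∀ (P : Fin n → Bool) → ∃ (λ v → P v ≡ true) →
  (6 ℕ.+ 3 ℕ.* p) ℕ.* ∑ (λ u → ∑ (λ v → if P u ∧ P v then present (sign G u v) else 0))
    < (18 ℕ.+ 12 ℕ.* p) ℕ.* ∑ (λ v → if P v then 1 else 0)

size : ∀ {n} → SignedGraph n → ℕ
size G = ∑ (deg G)

Sparse-≤ : ∀ p {n} (G G′ : SignedGraph n) → (∀ u v → present (sign G′ u v) ℕ.≤ present (sign G u v)) →
           Sparse p G → Sparse p G′
Sparse-≤ p G G′ G′≤G sparse P nonempty = ℕ.≤-<-trans
  (ℕ.*-monoʳ-≤ (6 ℕ.+ 3 ℕ.* p) (∑-mono (λ u → ∑-mono (λ v → if-mono (P u ∧ P v) (G′≤G u v)))))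
  (sparse P nonempty)
  where
  if-mono : ∀ b {i j} → i ℕ.≤ j → (if b then i else 0) ℕ.≤ (if b then j else 0)
  if-mono true  i≤j = i≤j
  if-mono false _   = z≤n

module _ {p : ℕ} (2≤p : 2 ℕ.≤ p) (H : SignedGraph (6 ℕ.+ 4 ℕ.* p))
  (complete : ∀ {i j} → i ≢ j → sign H i j ≢ nothing)
  (orthogonal : ∀ {i j} → i ≢ j → ∑ᶻ (λ l → value (sign H l i) ℤ.* value (sign H l j)) ≡ 0ℤ)
  {n : ℕ}
  where

  open Discharging p
  open import Data.Nat.Base using (_*_; _≤_)
  open Recolouring H (ℕ.≤-trans (s≤s z≤n) 2≤p) complete orthogonal using (recolour)

  size-deleteStar : ∀ (G : SignedGraph n) a W → Reducible G a W → size (deleteStar G a W) < size G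
  size-deleteStar G a W red with w , Ww ← Discharging.Reducible.nonempty red with s , aw ← Discharging.Reducible.neighbours red Ww =
    ∑-mono-< (λ u → ∑-mono (deleteStar-≤ G a W u)) a
      (∑-mono-< (deleteStar-≤ G a W a) w (strict Ww aw))
    where
    strict : ∀ {w s} → W w ≡ true → sign G a w ≡ just s →
             present (sign (deleteStar G a W) a w) < present (sign G a w)
    strict {w} Ww aw rewrite deleteStar-centre G a W w | Ww | aw = s≤s z≤n

  recolour-reducible : ∀ (G : SignedGraph n) a W → Reducible G a W →
    ∃ (IsColouring (deleteStar G a W) H) → ∃ (IsColouring G H)
  recolour-reducible G a W red = recolour G G′ a W neighbours independent
    (λ {v} Wv → trans (deleteStar-centre G a W v) (cong (λ b → if b then nothing else sign G a v) Wv))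
    (deleteStar-other G a W)
    (λ Ww → ℕ.≤-pred (subst (ℕ._≤ 3) (leaf Ww) (weak Ww)))
    (subst₂ _<_ (∑-cong (λ w → cost-leaf w (W w) refl)) (cong (guaranteed p) (∑-cong rest)) few)
    where
    open Discharging.Reducible red
    G′ : SignedGraph n
    G′ = deleteStar G a W

    leaf : ∀ {w} → W w ≡ true → deg G w ≡ suc (deg G′ w)
    leaf = deg-leaf G a W neighbours

    cost-leaf : ∀ w b → W w ≡ b → (if b then deg G w ℕ.∸ 1 else 0) ≡ (if b then deg G′ w else 0)
    cost-leaf w true  Ww = cong (ℕ._∸ 1) (leaf Ww)
    cost-leaf w false _  = refl

    rest : ∀ u → (if W u then 0 else present (sign G a u)) ≡ present (sign G′ a u)
    rest u = trans (if-present (W u)) (cong present (sym (deleteStar-centre G a W u)))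
      where
      if-present : ∀ b {k : Maybe Sign} → (if b then 0 else present k) ≡ present (if b then nothing else k)
      if-present true  = refl
      if-present false = refl

  -- The set of nonisolated vertices contains both ends of every edge. Were it nonempty, sparsity on
  -- this set would contradict the charge bound.
  uncharged⇒edgeless : ∀ (G : SignedGraph n) → Sparse p G →
    target G * ∑ (nonisolated G) ≤ unit G * size G → ∀ v → ¬ 0 < deg G v
  uncharged⇒edgeless G sparse charged v 0<deg = ℕ.<⇒≱ (sparse P (v , dec-true (0 ℕ.<? deg G v) 0<deg))
    (subst (λ e → target G * ∑ (nonisolated G) ≤ unit G * e)
      (∑-cong (λ u → ∑-cong (λ w → sym (within u w (sign G u w) refl)))) charged)
    where
    P : Fin n → Bool
    P v = does (0 ℕ.<? deg G v)

    within : ∀ u w k → sign G u w ≡ k → (if P u ∧ P w then present (sign G u w) else 0) ≡ present (sign G u w)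
    within u w k uw with P u ∧ P w in eq
    ... | true  = refl
    within u w nothing  uw | false = cong present (sym uw)
    within u w (just s) uw | false with () ← trans (sym eq) (cong₂ _∧_
      (dec-true (0 ℕ.<? deg G u) (edge⇒deg>0 G uw))
      (dec-true (0 ℕ.<? deg G w) (edge⇒deg>0 G (trans (symmetric G w u) uw))))

  sparse⇒colouring : ∀ (G : SignedGraph n) → Sparse p G → ∃ (IsColouring G H)
  sparse⇒colouring G = <-rec (λ k → ∀ (G : SignedGraph n) → size G ≡ k → Sparse p G → ∃ (IsColouring G H))
                             step (size G) G refl
    where
    step : ∀ k → (∀ {j} → j < k → ∀ (G : SignedGraph n) → size G ≡ j → Sparse p G → ∃ (IsColouring G H)) →
           ∀ (G : SignedGraph n) → size G ≡ k → Sparse p G → ∃ (IsColouring G H)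
    step _ smaller G refl sparse with reducible-or-charged G 2≤p
    ... | inj₁ (a , W , red) = recolour-reducible G a W red
            (smaller (size-deleteStar G a W red) (deleteStar G a W) refl
              (Sparse-≤ p G (deleteStar G a W) (deleteStar-≤ G a W) sparse))
    -- There is no edge left, so a constant map is a colouring.
    ... | inj₂ charged = (λ _ → zero , Sign.+) , λ u v s uv →
            ⊥-elim (uncharged⇒edgeless G sparse charged u (edge⇒deg>0 G uv))

-- Maximum average degree

open import Data.Rational.Base as ℚ using (_/_; _-_; 0ℚ; toℚᵘ) renaming (_<_ to _<ℚ_; _≤_ to _≤ℚ_)

module _ where
  open import Data.Nat.Base using (_+_; _*_; _≤_)

  -- Reduction to lowest terms does not compute for a variable `q`, so the comparison is carried out
  -- in unnormalised rationals, where it is cross-multiplication. The term with 8 is moved to the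
  -- left to avoid subtraction of naturals.
  /-<⇒ : ∀ a l q → + a / suc l <ℚ + 4 / 1 - + 8 / (3 + q) → a * (3 + q) + 8 * suc l < 4 * (3 + q) * suc l
  /-<⇒ a l q a/l< = ℤ.drop‿+<+ (begin-strict
    + (a * (3 + q) + 8 * suc l)                         ≡⟨ ℤ.pos-+ (a * (3 + q)) _ ⟩
    + (a * (3 + q)) ℤ.+ + (8 * suc l)                   ≡⟨ cong₂ ℤ._+_ (ℤ.pos-* a (3 + q)) (ℤ.pos-* 8 (suc l)) ⟩
    + a ℤ.* + (3 + q) ℤ.+ + 8 ℤ.* + suc l               <⟨ ℤ.+-monoˡ-< (+ 8 ℤ.* + suc l) cross ⟩
    (+ 4 ℤ.* + (3 + q) ℤ.+ ℤ.- + 8 ℤ.* 1ℤ) ℤ.* + suc l ℤ.+ + 8 ℤ.* + suc l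
                                                        ≡⟨ arith (+ (3 + q)) (+ suc l) ⟩
    + 4 ℤ.* + (3 + q) ℤ.* + suc l                       ≡⟨ cong (ℤ._* + suc l) (ℤ.pos-* 4 (3 + q)) ⟨
    + (4 * (3 + q)) ℤ.* + suc l                         ≡⟨ ℤ.pos-* (4 * (3 + q)) (suc l) ⟨
    + (4 * (3 + q) * suc l)                             ∎)
    where
    open ℤ.≤-Reasoning
    arith : ∀ x y → (+ 4 ℤ.* x ℤ.+ ℤ.- + 8 ℤ.* 1ℤ) ℤ.* y ℤ.+ + 8 ℤ.* y ≡ + 4 ℤ.* x ℤ.* y
    arith = ℤSolver.solve-∀

    unnormalised : toℚᵘ (+ 4 / 1 - + 8 / (3 + q)) ℚᵘ.≃ mkℚᵘ (+ 4) 0 ℚᵘ.- mkℚᵘ (+ 8) (2 + q)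
    unnormalised = ℚᵘ.≃-trans (ℚ.toℚᵘ-homo-+ (+ 4 / 1) (ℚ.- (+ 8 / (3 + q))))
      (ℚᵘ.+-cong {toℚᵘ (+ 4 / 1)} {mkℚᵘ (+ 4) 0} (ℚ.toℚᵘ-fromℚᵘ (mkℚᵘ (+ 4) 0))
        (ℚᵘ.≃-trans (ℚ.toℚᵘ-homo‿- (+ 8 / (3 + q))) (ℚᵘ.-‿cong (ℚ.toℚᵘ-fromℚᵘ (mkℚᵘ (+ 8) (2 + q))))))

    cross : + a ℤ.* + (3 + q) ℤ.< (+ 4 ℤ.* + (3 + q) ℤ.+ ℤ.- + 8 ℤ.* 1ℤ) ℤ.* + suc l
    -- The unnormalised difference has denominator `1 * (3 + q)`, which computes to `3 + q + 0`.
    cross = subst (λ d → + a ℤ.* + d ℤ.< (+ 4 ℤ.* + (3 + q) ℤ.+ ℤ.- + 8 ℤ.* 1ℤ) ℤ.* + suc l) (ℕ.+-identityʳ (3 + q))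
      (ℚᵘ.drop-*<* (ℚᵘ.<-respʳ-≃ unnormalised
        (ℚᵘ.<-respˡ-≃ (ℚ.toℚᵘ-fromℚᵘ (mkℚᵘ (+ a) l)) (ℚ.toℚᵘ-mono-< a/l<))))

-- Edge counts of induced subgraphs

module _ {A : Set} where

  ∈-sublists-filter : ∀ {P : A → Set} (P? : ∀ x → Dec (P x)) xs → List.filter P? xs ∈ sublists xs
  ∈-sublists-filter P? []       = here refl
  ∈-sublists-filter P? (x ∷ xs) with does (P? x)
  ... | true  = ∈-++⁺ˡ (∈-map⁺ (x ∷_) (∈-sublists-filter P? xs))
  ... | false = ∈-++⁺ʳ _ (∈-sublists-filter P? xs)

  ∈-sublists-refl : ∀ (xs : List A) → xs ∈ sublists xs
  ∈-sublists-refl []       = here refl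
  ∈-sublists-refl (x ∷ xs) = ∈-++⁺ˡ (∈-map⁺ (x ∷_) (∈-sublists-refl xs))

  length-filter-tabulate : ∀ {P : A → Set} (P? : ∀ x → Dec (P x)) {n} (g : Fin n → A) →
    length (List.filter P? (List.tabulate g)) ≡ ∑ (λ i → ⟦ P? (g i) ⟧)
  length-filter-tabulate P? {zero}  g = sym (∑-empty _)
  length-filter-tabulate P? {suc n} g = trans step (sym (∑-suc _))
    where
    step : length (List.filter P? (g zero ∷ List.tabulate (g ∘ suc))) ≡ ⟦ P? (g zero) ⟧ ℕ.+ ∑ (λ i → ⟦ P? (g (suc i)) ⟧)
    step with does (P? (g zero))
    ... | true  = cong suc (length-filter-tabulate P? (g ∘ suc))
    ... | false = length-filter-tabulate P? (g ∘ suc)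

  length-filter-filter : ∀ {P Q : A → Set} (P? : ∀ x → Dec (P x)) (Q? : ∀ x → Dec (Q x)) xs →
    length (List.filter P? (List.filter Q? xs)) ≡ length (List.filter (λ x → Q? x ×-dec P? x) xs)
  length-filter-filter P? Q? []       = refl
  length-filter-filter P? Q? (x ∷ xs) with does (Q? x)
  ... | false = length-filter-filter P? Q? xs
  ... | true with does (P? x)
  ...   | true  = cong suc (length-filter-filter P? Q? xs)
  ...   | false = length-filter-filter P? Q? xs

length-filter-cartesianProduct : ∀ {A B : Set} {P : A × B → Set} (P? : ∀ x → Dec (P x)) {m n}
  (g : Fin m → A) (h : Fin n → B) →
  length (List.filter P? (List.cartesianProduct (List.tabulate g) (List.tabulate h)))
    ≡ ∑ (λ i → ∑ (λ j → ⟦ P? (g i , h j) ⟧))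
length-filter-cartesianProduct P? {zero}  g h = sym (∑-empty _)
length-filter-cartesianProduct P? {suc m} g h = begin
  length (List.filter P? (row List.++ rows))
    ≡⟨ cong length (filter-++ P? row rows) ⟩
  length (List.filter P? row List.++ List.filter P? rows)
    ≡⟨ length-++ (List.filter P? row) ⟩
  length (List.filter P? row) ℕ.+ length (List.filter P? rows)
    ≡⟨ cong₂ ℕ._+_ (trans (cong (length ∘ List.filter P?) (map-tabulate h (g zero ,_)))
                          (length-filter-tabulate P? (λ j → g zero , h j)))
                   (length-filter-cartesianProduct P? (g ∘ suc) h) ⟩
  ∑ (λ j → ⟦ P? (g zero , h j) ⟧) ℕ.+ ∑ (λ i → ∑ (λ j → ⟦ P? (g (suc i) , h j) ⟧))
    ≡⟨ ∑-suc _ ⟨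
  ∑ (λ i → ∑ (λ j → ⟦ P? (g i , h j) ⟧)) ∎
  where
  open ≡-Reasoning
  row  = map (g zero ,_) (List.tabulate h)
  rows = List.cartesianProduct (List.tabulate (g ∘ suc)) (List.tabulate h)

⟦⟧-× : ∀ {P Q : Set} (d : Dec P) (e : Dec Q) → ⟦ d ×-dec e ⟧ ≡ ⟦ d ⟧ ℕ.* ⟦ e ⟧
⟦⟧-× (yes _) e = sym (ℕ.+-identityʳ ⟦ e ⟧)
⟦⟧-× (no _)  e = refl

module _ {n : ℕ} (G : SignedGraph n) (P : Fin n → Bool) where
  open import Data.Nat.Base using (_+_; _*_; _≤_)
  open import Data.List.Membership.DecPropositional (Fin._≟_ {n}) using (_∈?_)

  private
    P? : ∀ v → Dec (P v ≡ true)
    P? v = P v Bool.≟ true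

  support : List (Fin n)
  support = List.filter P? (allFin n)

  ⟦P?⟧ : ∀ v → ⟦ P? v ⟧ ≡ (if P v then 1 else 0)
  ⟦P?⟧ v with P v
  ... | true  = refl
  ... | false = refl

  length-support : length support ≡ ∑ (λ v → if P v then 1 else 0)
  length-support = trans (length-filter-tabulate P? id) (∑-cong ⟦P?⟧)

  within : Fin n → Fin n → ℕ
  within u v = if P u ∧ P v then present (sign G u v) else 0

  within-symmetric : ∀ u v → within u v ≡ within v u
  within-symmetric u v = cong₂ (λ b k → if b then present k else 0) (Bool.∧-comm (P u) (P v)) (symmetric G u v)

  within-diagonal : ∀ v → within v v ≡ 0
  within-diagonal v rewrite loopless G v with P v ∧ P v
  ... | true  = refl
  ... | false = refl

  length-edgesWithin : length (edgesWithin G support) ≡ ∑ (λ u → ∑ (λ v → ⟦ u Fin.<? v ⟧ * within u v))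
  length-edgesWithin = begin
    length (edgesWithin G support)
      ≡⟨ length-filter-filter (λ (u , v) → u ∈? support ×-dec v ∈? support)
           (λ (u , v) → u Fin.<? v ×-dec T? (is-just (sign G u v))) (List.cartesianProduct (allFin n) (allFin n)) ⟩
    length (List.filter _ (List.cartesianProduct (allFin n) (allFin n)))
      ≡⟨ length-filter-cartesianProduct
           (λ (u , v) → (u Fin.<? v ×-dec T? (is-just (sign G u v))) ×-dec (u ∈? support ×-dec v ∈? support)) id id ⟩
    ∑ (λ u → ∑ (λ v → ⟦ (u Fin.<? v ×-dec T? (is-just (sign G u v))) ×-dec (u ∈? support ×-dec v ∈? support) ⟧))
      ≡⟨ ∑-cong (λ u → ∑-cong (λ v → pointwise u v)) ⟩
    ∑ (λ u → ∑ (λ v → ⟦ u Fin.<? v ⟧ * within u v)) ∎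
    where
    open ≡-Reasoning
    ⟦∈?⟧ : ∀ v → ⟦ v ∈? support ⟧ ≡ (if P v then 1 else 0)
    ⟦∈?⟧ v = trans (⟦⟧-cong (v ∈? support) (P? v) (λ v∈ → proj₂ (∈-filter⁻ P? {xs = allFin n} v∈))
                                                    (∈-filter⁺ P? (∈-allFin v)))
                   (⟦P?⟧ v)

    combine : ∀ {B : Set} (k : Maybe B) b c →
      ⟦ T? (is-just k) ⟧ * ((if b then 1 else 0) * (if c then 1 else 0)) ≡ (if b ∧ c then present k else 0)
    combine nothing  true  true  = refl
    combine nothing  true  false = refl
    combine nothing  false _     = refl
    combine (just _) true  true  = refl
    combine (just _) true  false = refl
    combine (just _) false _     = refl

    pointwise : ∀ u v → ⟦ (u Fin.<? v ×-dec T? (is-just (sign G u v))) ×-dec (u ∈? support ×-dec v ∈? support) ⟧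
                      ≡ ⟦ u Fin.<? v ⟧ * within u v
    pointwise u v = begin
      ⟦ (u Fin.<? v ×-dec edge?) ×-dec (u ∈? support ×-dec v ∈? support) ⟧
        ≡⟨ ⟦⟧-× (u Fin.<? v ×-dec edge?) (u ∈? support ×-dec v ∈? support) ⟩
      ⟦ u Fin.<? v ×-dec edge? ⟧ * ⟦ u ∈? support ×-dec v ∈? support ⟧
        ≡⟨ cong₂ _*_ (⟦⟧-× (u Fin.<? v) edge?) (trans (⟦⟧-× (u ∈? support) (v ∈? support)) (cong₂ _*_ (⟦∈?⟧ u) (⟦∈?⟧ v))) ⟩
      ⟦ u Fin.<? v ⟧ * ⟦ edge? ⟧ * ((if P u then 1 else 0) * (if P v then 1 else 0))
        ≡⟨ ℕ.*-assoc ⟦ u Fin.<? v ⟧ _ _ ⟩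
      ⟦ u Fin.<? v ⟧ * (⟦ edge? ⟧ * ((if P u then 1 else 0) * (if P v then 1 else 0)))
        ≡⟨ cong (⟦ u Fin.<? v ⟧ *_) (combine (sign G u v) (P u) (P v)) ⟩
      ⟦ u Fin.<? v ⟧ * within u v ∎
      where
      edge? = T? (is-just (sign G u v))

  -- Each edge is listed with its smaller end first; the transposed sum supplies the other
  -- orientation, and the diagonal vanishes.
  2*length-edgesWithin : 2 * length (edgesWithin G support) ≡ ∑ (λ u → ∑ (λ v → within u v))
  2*length-edgesWithin = sym (begin
    ∑ (λ u → ∑ (λ v → within u v))
      ≡⟨ ∑-cong (λ u → trans (∑-cong (λ v → split u v)) (∑-+ _ _)) ⟩
    ∑ (λ u → ∑ (λ v → ⟦ u Fin.<? v ⟧ * within u v) + ∑ (λ v → ⟦ v Fin.<? u ⟧ * within v u))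
      ≡⟨ ∑-+ _ _ ⟩
    ∑ (λ u → ∑ (λ v → ⟦ u Fin.<? v ⟧ * within u v)) + ∑ (λ u → ∑ (λ v → ⟦ v Fin.<? u ⟧ * within v u))
      ≡⟨ cong₂ _+_ (sym length-edgesWithin) (trans (∑-swap _) (sym length-edgesWithin)) ⟩
    length (edgesWithin G support) + length (edgesWithin G support)
      ≡⟨ cong (length (edgesWithin G support) ℕ.+_) (ℕ.+-identityʳ _) ⟨
    2 * length (edgesWithin G support) ∎)
    where
    open ≡-Reasoning
    split : ∀ u v → within u v ≡ ⟦ u Fin.<? v ⟧ * within u v + ⟦ v Fin.<? u ⟧ * within v u
    split u v with Fin.<-cmp u v
    ... | tri< u<v _ v≮u rewrite ⟦⟧-true (u Fin.<? v) u<v | ⟦⟧-false (v Fin.<? u) v≮u =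
          sym (trans (ℕ.+-identityʳ _) (ℕ.+-identityʳ _))
    ... | tri> u≮v _ v<u rewrite ⟦⟧-false (u Fin.<? v) u≮v | ⟦⟧-true (v Fin.<? u) v<u =
          trans (within-symmetric u v) (sym (ℕ.+-identityʳ _))
    ... | tri≈ _ refl _ rewrite within-diagonal u = sym (cong₂ _+_ (ℕ.*-zeroʳ ⟦ u Fin.<? u ⟧) (ℕ.*-zeroʳ ⟦ u Fin.<? u ⟧))

module _ {n : ℕ} (G : SignedGraph n) where
  open import Data.Nat.Base using (_+_; _*_; _≤_)

  averageDegree≤mad : ∀ {x U} → x ∷ U ∈ sublists (allFin n) →
    + (2 * length (edgesWithin G (x ∷ U))) / suc (length U) ≤ℚ mad G
  averageDegree≤mad {x} {U} U∈ = All.lookup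
    (Extrema.xs≤max (DecTotalOrder.totalOrder ℚ.≤-decTotalOrder) 0ℚ (List.concatMap (averageDegreesOn G) (sublists (allFin n))))
    (∈-concatMap⁺ (averageDegreesOn G)
      -- Among the subgraphs on this vertex set the induced one is taken, with all edges kept.
      (Any.map (λ { refl → ∈-map⁺ (λ F → + (2 * length F) / suc (length U)) (∈-sublists-refl (edgesWithin G (x ∷ U))) }) U∈))

  mad<⇒Sparse : ∀ p → mad G <ℚ + 4 / 1 - + 8 / (3 + (5 + 4 * p)) → Sparse p G
  mad<⇒Sparse p mad< P (v , Pv) = by-support (support G P) refl
    where
    E L : ℕ
    E = ∑ (λ u → ∑ (λ v → within G P u v))
    L = ∑ (λ v → if P v then 1 else 0)

    -- The factor 3/4 turns `q + 3 = 8 + 4 * p` into `6 + 3 * p`; hence a multiplication by 3, and a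
    -- cancellation of 4 once the term with 8 is removed.
    clear-denominators : ∀ {l k} → suc l ≡ k → E * (3 + (5 + 4 * p)) + 8 * suc l < 4 * (3 + (5 + 4 * p)) * suc l →
                         (6 + 3 * p) * E < (18 + 12 * p) * k
    clear-denominators {l} refl E< = ℕ.*-cancelˡ-< 4 _ _ (ℕ.+-cancelʳ-< (3 * (8 * suc l)) _ _
      (subst₂ _<_ (arithˡ p E (suc l)) (arithʳ p (suc l)) (ℕ.*-monoʳ-< 3 E<)))
      where
      arithˡ : ∀ p e l → 3 * (e * (3 + (5 + 4 * p)) + 8 * l) ≡ 4 * ((6 + 3 * p) * e) + 3 * (8 * l)
      arithˡ = ℕSolver.solve-∀
      arithʳ : ∀ p l → 3 * (4 * (3 + (5 + 4 * p)) * l) ≡ 4 * ((18 + 12 * p) * l) + 3 * (8 * l)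
      arithʳ = ℕSolver.solve-∀

    by-support : ∀ U → support G P ≡ U → (6 + 3 * p) * E < (18 + 12 * p) * L
    by-support [] eq with () ← subst (v ∈_) eq (∈-filter⁺ (λ v → P v Bool.≟ true) (∈-allFin v) Pv)
    by-support (x ∷ U) eq = clear-denominators (trans (cong length (sym eq)) (length-support G P))
      (subst (λ e → e * (3 + (5 + 4 * p)) + 8 * suc (length U) < 4 * (3 + (5 + 4 * p)) * suc (length U))
        (trans (cong (λ U → 2 * length (edgesWithin G U)) (sym eq)) (2*length-edgesWithin G P))
        (/-<⇒ (2 * length (edgesWithin G (x ∷ U))) (length U) (5 + 4 * p) (ℚ.≤-<-trans
          (averageDegree≤mad (subst (_∈ sublists (allFin n)) eq (∈-sublists-filter (λ v → P v Bool.≟ true) (allFin n))))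
          mad<)))

-- Specialisation to the signed Paley graph

1+4k>9 : ∀ {q} → 9 < q → q % 4 ≡ 1 → ∃ λ p → 2 ℕ.≤ p × q ≡ 5 ℕ.+ 4 ℕ.* p
1+4k>9 {q} 9<q q≡1 = from-quotient (q ℕ./ 4) (trans (m≡m%n+[m/n]*n q 4) (cong₂ ℕ._+_ q≡1 (ℕ.*-comm (q ℕ./ 4) 4)))
  where
  from-quotient : ∀ k → q ≡ 1 ℕ.+ 4 ℕ.* k → ∃ λ p → 2 ℕ.≤ p × q ≡ 5 ℕ.+ 4 ℕ.* p
  -- The quotients 0, 1 and 2 belong to the orders 1, 5 and 9.
  from-quotient 0 refl = ⊥-elim (ℕ.<⇒≱ 9<q (by-decision (_ ℕ.≤? _)))
  from-quotient 1 refl = ⊥-elim (ℕ.<⇒≱ 9<q (by-decision (_ ℕ.≤? _)))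
  from-quotient 2 refl = ⊥-elim (ℕ.<⇒≱ 9<q (by-decision (_ ℕ.≤? _)))
  from-quotient (suc p@(suc (suc _))) q≡ = p , s≤s (s≤s z≤n) , trans q≡ (cong suc (ℕ.*-suc 4 p))

theorem4 : (q : ℕ) → 9 < q → IsPrimePower q → (q≡1 : q % 4 ≡ 1) → (F : FiniteField q) →
    let k = + 4 / 1 - + 8 / (3 +ℕ q) in
    ((n : ℕ) (G : SignedGraph n) → mad G <ℚ k → G ⟶ (SP F q≡1) ⁺) × χₛ[ 𝓜 k ]≤ (suc q)
theorem4 q 9<q _ q≡1 F with 1+4k>9 9<q q≡1
... | p , 2≤p , refl = (λ n → hom) , λ G mad< → chromaticNumber≤ G ((SP F q≡1) ⁺ , hom G mad<)
  where
  hom : ∀ {n} (G : SignedGraph n) → mad G <ℚ + 4 / 1 - + 8 / (3 +ℕ q) → G ⟶ (SP F q≡1) ⁺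
  hom G mad< with f , f-col ← sparse⇒colouring 2≤p ((SP F q≡1) ⁺) (SP⁺-complete F q≡1) (SP⁺-orthogonal F q≡1)
                                G (mad<⇒Sparse G p mad<) =
    colouring⇒homomorphism G _ f f-col
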